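{- Let $(a,b;c)$ be admissible hypergeometric parameters and let $D$ be the least common multiple of the denominators of $a$, $b$, $c$. Then the following are equivalent: (i) $c<a$ and $c<b$; (ii) $S(a,b;c)$ contains all but finitely many primes; (iii) $S(a,b;c)$ contains infinitely many primes $p$ with $p\equiv1\pmod D$.
   Context: $(a,b;c)$ rational is admissible if $0<a,b,c<1$ and $c\ne a$, $c\ne b$. ${}_2F_1(a,b;c;z)=\sum_{m\ge0}\frac{(a)_m(b)_m}{(c)_m}\frac{z^m}{m!}$ with $(x)_0=1$, $(x)_m=x(x+1)\cdots(x+m-1)$. $S(a,b;c)$ is the set of primes $p$ such that ${}_2F_1(a,b;c;z)$ has $p$-adically unbounded coefficients, i.e. $\inf_m v_p(A_m)=-\infty$ where $A_m$ is the $m$-th coefficient. -}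

module Defs where

open import Data.Nat as ℕ using (ℕ; zero; suc; _!; _^_)
open import Data.Nat.Divisibility using (_∣_)
open import Data.Nat.LCM using (lcm)
open import Data.Integer using (+_)
open import Data.Rational
  using (ℚ; 0ℚ; 1ℚ; _+_; _*_; _÷_; _≟_; ≢-nonZero; ↧ₙ_; _<_)
  renaming (_/_ to _//_)
open import Data.Product using (Σ; ∃; _×_)
open import Relation.Binary.PropositionalEquality using (_≡_; _≢_)
open import Relation.Nullary using (yes; no)

ℕ→ℚ : ℕ → ℚ
ℕ→ℚ n = (+ n) // 1

poch : ℚ → ℕ → ℚ
poch x zero    = 1ℚ
poch x (suc m) = poch x m * (x + ℕ→ℚ m)

-- total division: x / y for y ≠ 0 (and 0 when y = 0, never used
-- for admissible parameters since then all denominators are nonzero)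
_⊘_ : ℚ → ℚ → ℚ
x ⊘ y with y ≟ 0ℚ
... | yes _  = 0ℚ
... | no y≢0 = _÷_ x y {{≢-nonZero y≢0}}

-- m-th coefficient of 2F1(a,b;c;z)
coeff : ℚ → ℚ → ℚ → ℕ → ℚ
coeff a b c m = (poch a m * poch b m) ⊘ (poch c m * ℕ→ℚ (m !))

Admissible : ℚ → ℚ → ℚ → Set
Admissible a b c =
  (0ℚ < a × a < 1ℚ) × (0ℚ < b × b < 1ℚ) × (0ℚ < c × c < 1ℚ) ×
  (c ≢ a) × (c ≢ b)

-- a sequence of rationals is p-adically unbounded: inf_m v_p(f m) = -∞,
-- i.e. for every k some term has v_p ≤ -k, i.e. p^k divides its
-- reduced denominator
PAdicUnbounded : ℕ → (ℕ → ℚ) → Set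
PAdicUnbounded p f = ∀ (k : ℕ) → ∃ λ m → p ^ k ∣ ↧ₙ (f m)

InS : ℚ → ℚ → ℚ → ℕ → Set
InS a b c p = PAdicUnbounded p (coeff a b c)

denLcm : ℚ → ℚ → ℚ → ℕ
denLcm a b c = lcm (lcm (↧ₙ a) (↧ₙ b)) (↧ₙ c)

{-# OPTIONS --safe #-}
-- With a = α / D, b = β / D, c = γ / D, the m-th coefficient is
-- Q α m * Q β m / (Q γ m * Q D m), where Q α m = Π_{i<m} (α + i D).  For p ∤ D the
-- multiples of p among the factors of Q α m are p times those of Q α′ m′, where α ↦ α′
-- is Dwork's prime map, of period k + 1 if p ^ (k + 1) ≡ 1 mod D.
--
-- (i) ⇒ (ii): for p > D some digit d satisfies pγ/D < d ≤ pα/D, pβ/D.  Passing from ν to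
-- p ^ k * (d + ν p) peels the same powers of p off all four products, except for one
-- more off Q γ, so that p ^ R divides the denominator after R such passages.
--
-- (iii) ⇒ (i): if p ≡ 1 mod D then α′ = α, and m′ decreases with α; by strong induction,
-- v_p (Q γ m) ≤ v_p (Q α m) whenever α ≤ γ ≤ D.  If, say, α ≤ γ, pairing γ with α and D
-- with β makes every coefficient p-integral.
--
-- (ii) ⇒ (iii) requires infinitely many primes ≡ 1 mod n.  With U d = 1 - x ^ d, a prime
-- that divides U m but no U d for a proper divisor d of m is ≡ 1 mod m by Fermat.  If
-- there were none, the inclusion-exclusion products of the U (m / s), s squarefree with an
-- even resp. odd number of prime factors, would agree up to units at each prime, hence
-- in absolute value; modulo x ^ (n + 1), with n the smallest exponent, one is 1 - x ^ n
-- and the other is 1.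
module Submission where

open import Defs
open import Data.Nat
open import Data.Nat.Combinatorics
  using (_C_; nCk+nC[k+1]≡[n+1]C[k+1]; nCk≡n!/k![n-k]!; k![n∸k]!∣n!; nCn≡1; k>n⇒nCk≡0)
open import Data.Nat.Coprimality as Coprime using (Coprime; coprime-divisor)
open import Data.Nat.Divisibility
open import Data.Nat.DivMod
open import Data.Nat.GCD
open import Data.Nat.Induction using (<-rec)
open import Data.Nat.LCM using (lcm; m∣lcm[m,n]; n∣lcm[m,n]; lcm-least)
open import Data.Nat.ListAction using (product)
open import Data.Nat.Primality
open import Data.Nat.Primality.Factorisation using (factorise; factorisationHasAllPrimeFactors)
open import Data.Nat.Properties
open import Data.Nat.Tactic.RingSolver using (solve-∀)
open import Data.Integer as ℤ using (ℤ; +_; -[1+_]; ∣_∣; 0ℤ; 1ℤ; +<+)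
open import Data.Integer.Divisibility.Signed as ℤ∣ using (∣ᵤ⇒∣; ∣⇒∣ᵤ) renaming (_∣_ to _∣ℤ_)
import Data.Integer.Properties as ℤ
import Data.Integer.Tactic.RingSolver as ℤ-Solver
open import Data.Rational as ℚ using (ℚ; mkℚ; toℚᵘ; 0ℚ; 1ℚ; ↥_; ↧ₙ_; *<*) renaming (_<_ to _<ℚ_)
import Data.Rational.Properties as ℚ
open import Data.Rational.Unnormalised as ℚᵘ using (mkℚᵘ; *≡*)
import Data.Rational.Unnormalised.Properties as ℚᵘ
open import Data.Fin using (toℕ)
open import Data.Fin.Properties using (pigeonhole; toℕ-fromℕ<)
open import Data.List using (List; []; _∷_; filter; upTo)
open import Data.List.Membership.Propositional using (_∈_)
open import Data.List.Membership.Propositional.Properties using (∈-filter⁺; ∈-upTo⁺)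
open import Data.List.Relation.Unary.All as All using (All; []; _∷_)
open import Data.List.Relation.Unary.All.Properties using (all-filter)
open import Data.List.Relation.Unary.AllPairs using (_∷_)
open import Data.List.Relation.Unary.Any using (here; there)
open import Data.List.Relation.Unary.Unique.Propositional using (Unique)
open import Data.List.Relation.Unary.Unique.Propositional.Properties using (filter⁺; upTo⁺)
open import Data.Product using (∃; _×_; _,_; proj₁; proj₂; swap)
open import Data.Sum using (_⊎_; inj₁; inj₂; [_,_]′)
open import Algebra.Bundles using (CommutativeMonoid)
open import Algebra.Properties.CommutativeSemigroup
  (CommutativeMonoid.commutativeSemigroup ℚ.*-1-commutativeMonoid)
  using () renaming (interchange to *-interchange)
open import Function.Bundles using (_⇔_; mk⇔)
open import Relation.Nullary using (¬_; ¬?; _×-dec_; Dec; yes; no; contradiction)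
open import Relation.Binary.PropositionalEquality

-- Comparison of p-adic valuations

infix 4 _≼[_]_ _∼[_]_

-- v_p(a) ≤ v_p(b) for nonzero a and b, without valuations.
record _≼[_]_ (a p b : ℕ) : Set where
  constructor ≼-by
  field
    unit       : ℕ
    p∤unit     : p ∤ unit
    a∣b*unit   : a ∣ b * unit

_∼[_]_ : ℕ → ℕ → ℕ → Set
a ∼[ p ] b = a ≼[ p ] b × b ≼[ p ] a

prime∤1 : ∀ {p} → Prime p → p ∤ 1
prime∤1 pr p∣1 = ¬prime[1] (subst Prime (∣1⇒≡1 p∣1) pr)

prime∤* : ∀ {p u v} → Prime p → p ∤ u → p ∤ v → p ∤ u * v
prime∤* {p} {u} {v} pr p∤u p∤v p∣uv = [ p∤u , p∤v ]′ (euclidsLemma u v pr p∣uv)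

prime-∣⇒≡ : ∀ {p q} → Prime p → Prime q → p ∣ q → p ≡ q
prime-∣⇒≡ pr qr p∣q with prime⇒irreducible qr p∣q
... | inj₁ refl = contradiction pr ¬prime[1]
... | inj₂ p≡q  = p≡q

prime-∤⇒coprime : ∀ {p n} → Prime p → p ∤ n → Coprime p n
prime-∤⇒coprime pr p∤n (d∣p , d∣n) with prime⇒irreducible pr d∣p
... | inj₁ d≡1  = d≡1
... | inj₂ refl = contradiction d∣n p∤n

coprime-*ʳ : ∀ {m n o} → Coprime m n → Coprime m o → Coprime m (n * o)
coprime-*ʳ m⊥n m⊥o (d∣m , d∣no) =
  m⊥o (d∣m , coprime-divisor (λ (e∣d , e∣n) → m⊥n (∣-trans e∣d d∣m , e∣n)) d∣no)

coprime-^ʳ : ∀ {m n} k → Coprime m n → Coprime m (n ^ k)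
coprime-^ʳ zero    _   = λ (_ , d∣1) → ∣1⇒≡1 d∣1
coprime-^ʳ (suc k) m⊥n = coprime-*ʳ m⊥n (coprime-^ʳ k m⊥n)

primeDivisor : ∀ n → n ≢ 0 → n ≢ 1 → ∃ λ p → Prime p × p ∣ n
primeDivisor n n≢0 n≢1 with factorise n {{≢-nonZero n≢0}}
... | record { factors = []     ; isFactorisation = eq } = contradiction eq n≢1
... | record { factors = p ∷ ps ; isFactorisation = eq ; factorsPrime = pr ∷ _ } =
  p , pr , subst (p ∣_) (sym eq) (m∣m*n _)

module _ {p : ℕ} (pr : Prime p) where

  ∣⇒≼ : ∀ {a b} → a ∣ b → a ≼[ p ] b
  ∣⇒≼ a∣b = ≼-by 1 (prime∤1 pr) (∣m⇒∣m*n 1 a∣b)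

  ∼-refl : ∀ {a} → a ∼[ p ] a
  ∼-refl = ∣⇒≼ ∣-refl , ∣⇒≼ ∣-refl

  ≼-trans : ∀ {a b c} → a ≼[ p ] b → b ≼[ p ] c → a ≼[ p ] c
  ≼-trans {a} {b} {c} (≼-by u p∤u a∣bu) (≼-by v p∤v b∣cv) =
    ≼-by (v * u) (prime∤* pr p∤v p∤u)
      (subst (a ∣_) (*-assoc c v u) (∣-trans a∣bu (*-monoˡ-∣ u b∣cv)))

  ≼-* : ∀ {a b c d} → a ≼[ p ] b → c ≼[ p ] d → a * c ≼[ p ] b * d
  ≼-* {a} {b} {c} {d} (≼-by u p∤u a∣bu) (≼-by v p∤v c∣dv) =
    ≼-by (u * v) (prime∤* pr p∤u p∤v)
      (subst (a * c ∣_) ([m*n]*[o*p]≡[m*o]*[n*p] b u d v) (*-pres-∣ a∣bu c∣dv))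

  ∼-trans : ∀ {a b c} → a ∼[ p ] b → b ∼[ p ] c → a ∼[ p ] c
  ∼-trans (a≼b , b≼a) (b≼c , c≼b) = ≼-trans a≼b b≼c , ≼-trans c≼b b≼a

  ∼-* : ∀ {a b c d} → a ∼[ p ] b → c ∼[ p ] d → a * c ∼[ p ] b * d
  ∼-* (a≼b , b≼a) (c≼d , d≼c) = ≼-* a≼b c≼d , ≼-* b≼a d≼c

  ≼-*ˡ : ∀ c {a b} → a ≼[ p ] b → c * a ≼[ p ] c * b
  ≼-*ˡ c = ≼-* (∣⇒≼ (∣-refl {c}))

  ∼-*ˡ : ∀ c {a b} → a ∼[ p ] b → c * a ∼[ p ] c * b
  ∼-*ˡ c = ∼-* (∼-refl {c})

  ∼-respʳ : ∀ {a b c} → b ≡ c → a ∼[ p ] b → a ∼[ p ] c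
  ∼-respʳ refl a∼b = a∼b

  unit∼1 : ∀ {u} → p ∤ u → u ∼[ p ] 1
  unit∼1 {u} p∤u = ≼-by u p∤u (∣-reflexive (sym (*-identityˡ u))) , ∣⇒≼ (1∣ u)

  units∼ : ∀ {u v} → p ∤ u → p ∤ v → u ∼[ p ] v
  units∼ p∤u p∤v = ∼-trans (unit∼1 p∤u) (swap (unit∼1 p∤v))

  *-unit∼ : ∀ {a u} → p ∤ u → a * u ∼[ p ] a
  *-unit∼ {a} {u} p∤u = subst (a * u ∼[ p ]_) (*-identityʳ a) (∼-*ˡ a (unit∼1 p∤u))

-- After division by the gcd the cofactors `a′` and `b′` share no prime, so a prime dividing `a′`
-- would have to divide the unit. Hence `a′` has no prime divisor and is 1.
≼-everywhere⇒∣ : ∀ {a b} .{{_ : NonZero a}} .{{_ : NonZero b}} →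
  (∀ {p} → Prime p → a ≼[ p ] b) → a ∣ b
≼-everywhere⇒∣ {a} {b} a≼b = subst (_∣ b) g≡a (gcd[m,n]∣n a b)
  where
  g = gcd a b
  instance
    g≢0 : NonZero g
    g≢0 = ≢-nonZero (gcd[m,n]≢0 a b (inj₁ (≢-nonZero⁻¹ a)))
  a′ = quotient (gcd[m,n]∣m a b)
  b′ = quotient (gcd[m,n]∣n a b)
  a≡ : a ≡ g * a′
  a≡ = m∣n⇒n≡m*quotient (gcd[m,n]∣m a b)
  b≡ : b ≡ g * b′
  b≡ = m∣n⇒n≡m*quotient (gcd[m,n]∣n a b)
  no-common : ∀ {p} → Prime p → p ∣ a′ → p ∤ b′
  no-common {p} pr p∣a′ p∣b′ = prime∤1 pr (*-cancelˡ-∣ g (subst (g * p ∣_) (sym (*-identityʳ g))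
    (gcd-greatest (subst (g * p ∣_) (sym a≡) (*-monoʳ-∣ g p∣a′))
                  (subst (g * p ∣_) (sym b≡) (*-monoʳ-∣ g p∣b′)))))
  no-prime : ∀ {p} → Prime p → p ∤ a′
  no-prime {p} pr p∣a′ with a≼b pr
  ... | ≼-by u p∤u a∣bu = prime∤* pr (no-common pr p∣a′) p∤u
    (∣-trans p∣a′ (*-cancelˡ-∣ g (subst₂ _∣_ a≡ (trans (cong (_* u) b≡) (*-assoc g b′ u)) a∣bu)))
  a′≡1 : a′ ≡ 1
  a′≡1 with a′ ≟ 1
  ... | yes eq = eq
  ... | no a′≢1 with primeDivisor a′ (λ eq → ≢-nonZero⁻¹ a (trans a≡ (trans (cong (g *_) eq) (*-zeroʳ g)))) a′≢1
  ...   | p , pr , p∣a′ = contradiction p∣a′ (no-prime pr)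
  g≡a : g ≡ a
  g≡a = sym (trans a≡ (trans (cong (g *_) a′≡1) (*-identityʳ g)))

-- Fermat's little theorem

-- The truncation lets `fermat` treat the last term `x ^ p` apart from the others.
binomialSum : ℕ → ℕ → ℕ → ℕ
binomialSum n x zero    = 0
binomialSum n x (suc m) = binomialSum n x m + (n C m) * x ^ m

binomialSum-suc : ∀ n x m →
  binomialSum (suc n) x (suc m) ≡ binomialSum n x (suc m) + x * binomialSum n x m
binomialSum-suc n x zero    = sym (cong suc (*-zeroʳ x))
binomialSum-suc n x (suc m) = begin
  binomialSum (suc n) x (suc m) + (suc n C suc m) * x ^ suc m
    ≡⟨ cong₂ (λ s t → s + t * x ^ suc m) (binomialSum-suc n x m) (sym (nCk+nC[k+1]≡[n+1]C[k+1] n m)) ⟩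
  (s + (n C m) * x ^ m) + x * s + ((n C m) + (n C suc m)) * (x * x ^ m)
    ≡⟨ lemma s (n C m) (n C suc m) x (x ^ m) ⟩
  binomialSum n x (suc (suc m)) + x * binomialSum n x (suc m) ∎
  where
  open ≡-Reasoning
  s = binomialSum n x m
  lemma : ∀ s a b x y → (s + a * y) + x * s + (a + b) * (x * y) ≡ (s + a * y) + b * (x * y) + x * (s + a * y)
  lemma = solve-∀

binomial-theorem : ∀ n x → binomialSum n x (suc n) ≡ suc x ^ n
binomial-theorem zero    x = refl
binomial-theorem (suc n) x = begin
  binomialSum (suc n) x (suc (suc n))                                ≡⟨ binomialSum-suc n x (suc n) ⟩
  binomialSum n x (suc n) + (n C suc n) * x ^ suc n + x * binomialSum n x (suc n)
    ≡⟨ cong₂ (λ s t → s + t * x ^ suc n + x * s) (binomial-theorem n x) (k>n⇒nCk≡0 (n<1+n n)) ⟩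
  suc x ^ n + 0 + x * suc x ^ n                                      ≡⟨ cong (_+ x * suc x ^ n) (+-identityʳ (suc x ^ n)) ⟩
  suc x ^ suc n ∎
  where open ≡-Reasoning

prime∤! : ∀ {p} → Prime p → ∀ {n} → n < p → p ∤ n !
prime∤! pr {zero}  n<p = prime∤1 pr
prime∤! pr {suc n} n<p = prime∤* pr (>⇒∤ n<p) (prime∤! pr (<-trans (n<1+n n) n<p))

-- `p ! = (p C k) * (k ! * (p ∸ k) !)`, and both factorials on the right are products of positive
-- numbers below `p`.
prime∣C : ∀ {p} → Prime p → ∀ {k} → 0 < k → k < p → p ∣ p C k
prime∣C {p} pr {k} 0<k k<p with euclidsLemma (p C k) (k ! * (p ∸ k) !) pr (subst (p ∣_) (sym absorption) p∣p!)
  where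
  instance _ = k !* (p ∸ k) !≢0
  absorption : (p C k) * (k ! * (p ∸ k) !) ≡ p !
  absorption = trans (cong (_* (k ! * (p ∸ k) !)) (nCk≡n!/k![n-k]! (<⇒≤ k<p))) (m/n*n≡m (k![n∸k]!∣n! (<⇒≤ k<p)))
  p∣p! : p ∣ p !
  p∣p! = subst (λ n → n ∣ n !) (suc-pred p {{prime⇒nonZero pr}}) (m∣m*n _)
... | inj₁ p∣C = p∣C
... | inj₂ p∣d = contradiction p∣d (prime∤* pr (prime∤! pr k<p) (prime∤! pr (∸-monoʳ-< 0<k (<⇒≤ k<p))))

private
  binomialSum-mod : ∀ {p} → Prime p → ∀ x m → m < p → ∃ λ w → binomialSum p x (suc m) ≡ 1 + w * p
  binomialSum-mod pr x zero    m<p = 0 , refl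
  binomialSum-mod {p} pr x (suc m) m<p with binomialSum-mod pr x m (<-trans (n<1+n m) m<p) | prime∣C pr {suc m} z<s m<p
  ... | w , eq | divides q C≡ = w + q * x ^ suc m ,
    trans (cong₂ (λ s t → s + t * x ^ suc m) eq C≡) (lemma w p q (x ^ suc m))
    where
    lemma : ∀ w p q y → 1 + w * p + q * p * y ≡ 1 + (w + q * y) * p
    lemma = solve-∀

-- Induction on `x`: only the two end terms of the expansion of `suc x ^ p` survive modulo `p`.
fermat : ∀ {p} → Prime p → ∀ x → ∃ λ w → x ^ p ≡ x + w * p
fermat {suc n} pr zero    = 0 , refl
fermat {p@(suc n)} pr (suc x) with fermat pr x | binomialSum-mod pr x n (n<1+n n)
... | w , x^p≡ | v , sum≡ = v + w , (begin
  suc x ^ p                                 ≡⟨ binomial-theorem p x ⟨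
  binomialSum p x p + (p C p) * x ^ p       ≡⟨ cong₂ (λ s t → s + t * x ^ p) sum≡ (nCn≡1 p) ⟩
  1 + v * p + 1 * x ^ p                     ≡⟨ cong (λ y → 1 + v * p + 1 * y) x^p≡ ⟩
  1 + v * p + 1 * (x + w * p)               ≡⟨ lemma v p x w ⟩
  suc x + (v + w) * p                       ∎)
  where
  open ≡-Reasoning
  lemma : ∀ v p x w → 1 + v * p + 1 * (x + w * p) ≡ suc x + (v + w) * p
  lemma = solve-∀

-- Primes congruent to 1

infix 4 _≡_[mod_]

_≡_[mod_] : ℤ → ℤ → ℤ → Set
a ≡ b [mod z ] = z ∣ℤ a ℤ.- b

mod-refl : ∀ {a z} → a ≡ a [mod z ]
mod-refl {a} {z} = subst (z ∣ℤ_) (sym (ℤ.+-inverseʳ a)) (ℤ∣.divides 0ℤ refl)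

mod-* : ∀ {a b c d z} → a ≡ b [mod z ] → c ≡ d [mod z ] → a ℤ.* c ≡ b ℤ.* d [mod z ]
mod-* {a} {b} {c} {d} {z} a≡b c≡d = subst (z ∣ℤ_) (lemma a b c d)
  (ℤ∣.∣m∣n⇒∣m+n (ℤ∣.∣m⇒∣m*n c a≡b) (ℤ∣.∣n⇒∣m*n b c≡d))
  where
  lemma : ∀ a b c d → (a ℤ.- b) ℤ.* c ℤ.+ b ℤ.* (c ℤ.- d) ≡ a ℤ.* c ℤ.- b ℤ.* d
  lemma = ℤ-Solver.solve-∀

geometric : ℤ → ℕ → ℤ
geometric y zero    = 0ℤ
geometric y (suc q) = 1ℤ ℤ.+ y ℤ.* geometric y q

geometric-sum : ∀ y q → (1ℤ ℤ.- y) ℤ.* geometric y q ≡ 1ℤ ℤ.- y ℤ.^ q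
geometric-sum y zero    = ℤ.*-zeroʳ (1ℤ ℤ.- y)
geometric-sum y (suc q) = begin
  (1ℤ ℤ.- y) ℤ.* (1ℤ ℤ.+ y ℤ.* geometric y q)          ≡⟨ lemma₁ y (geometric y q) ⟩
  1ℤ ℤ.- y ℤ.+ y ℤ.* ((1ℤ ℤ.- y) ℤ.* geometric y q)    ≡⟨ cong (λ s → 1ℤ ℤ.- y ℤ.+ y ℤ.* s) (geometric-sum y q) ⟩
  1ℤ ℤ.- y ℤ.+ y ℤ.* (1ℤ ℤ.- y ℤ.^ q)                  ≡⟨ lemma₂ y (y ℤ.^ q) ⟩
  1ℤ ℤ.- y ℤ.* y ℤ.^ q                                 ∎
  where
  open ≡-Reasoning
  lemma₁ : ∀ y g → (1ℤ ℤ.- y) ℤ.* (1ℤ ℤ.+ y ℤ.* g) ≡ 1ℤ ℤ.- y ℤ.+ y ℤ.* ((1ℤ ℤ.- y) ℤ.* g)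
  lemma₁ = ℤ-Solver.solve-∀
  lemma₂ : ∀ y z → 1ℤ ℤ.- y ℤ.+ y ℤ.* (1ℤ ℤ.- z) ≡ 1ℤ ℤ.- y ℤ.* z
  lemma₂ = ℤ-Solver.solve-∀

-- Each of the `q` summands is a power of `y`, hence 1 modulo `1ℤ ℤ.- y`.
geometric-mod : ∀ y q → geometric y q ≡ + q [mod 1ℤ ℤ.- y ]
geometric-mod y zero    = mod-refl {0ℤ}
geometric-mod y (suc q) = subst (1ℤ ℤ.- y ∣ℤ_) (lemma y (geometric y q) (+ q))
  (ℤ∣.∣m∣n⇒∣m-n (geometric-mod y q) (ℤ∣.∣m⇒∣m*n (geometric y q) ℤ∣.∣-refl))
  where
  lemma : ∀ y g q → (g ℤ.- q) ℤ.- (1ℤ ℤ.- y) ℤ.* g ≡ (1ℤ ℤ.+ y ℤ.* g) ℤ.- (1ℤ ℤ.+ q)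
  lemma = ℤ-Solver.solve-∀

∼-abs-* : ∀ {p} → Prime p → ∀ a b c d → ∣ a ∣ ∼[ p ] ∣ b ∣ → ∣ c ∣ ∼[ p ] ∣ d ∣ → ∣ a ℤ.* c ∣ ∼[ p ] ∣ b ℤ.* d ∣
∼-abs-* pr a b c d a∼b c∼d rewrite ℤ.abs-* a c | ℤ.abs-* b d = ∼-* pr a∼b c∼d

module _ (x : ℕ) where

  private
    X = + x

  -- With this sign `U d` is 1 modulo `x ^ d`.
  U : ℕ → ℤ
  U d = 1ℤ ℤ.- X ℤ.^ d

  U-+ : ∀ k j → U (k + j) ≡ U k ℤ.+ X ℤ.^ k ℤ.* U j
  U-+ k j = trans (cong (λ z → 1ℤ ℤ.- z) (ℤ.^-distribˡ-+-* X k j)) (lemma (X ℤ.^ k) (X ℤ.^ j))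
    where
    lemma : ∀ y z → 1ℤ ℤ.- y ℤ.* z ≡ 1ℤ ℤ.- y ℤ.+ y ℤ.* (1ℤ ℤ.- z)
    lemma = ℤ-Solver.solve-∀

  U-∣ : ∀ {i j} → i ∣ j → U i ∣ℤ U j
  U-∣ {i} (divides zero    refl) = ℤ∣.divides 0ℤ refl
  U-∣ {i} (divides (suc q) refl) = subst (U i ∣ℤ_) (sym (U-+ i (q * i)))
    (ℤ∣.∣m∣n⇒∣m+n ℤ∣.∣-refl (ℤ∣.∣n⇒∣m*n (X ℤ.^ i) (U-∣ (divides q refl))))

  ∣U-∣ : ∀ {p i j} → i ∣ j → p ∣ ∣ U i ∣ → p ∣ ∣ U j ∣
  ∣U-∣ i∣j p∣ = ∣-trans p∣ (∣⇒∣ᵤ (U-∣ i∣j))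

  -- In `U (k + j) = U k + x ^ k * U j` the term `U k` has coefficient 1, so no power of `x` has to
  -- be cancelled.
  ∣U-difference : ∀ {p} i j k → k + j ≡ i → p ∣ ∣ U i ∣ → p ∣ ∣ U j ∣ → p ∣ ∣ U k ∣
  ∣U-difference {p} i j k refl p∣i p∣j = ∣⇒∣ᵤ {+ p} {U k}
    (ℤ∣.∣m+n∣n⇒∣m (subst (+ p ∣ℤ_) (U-+ k j) (∣ᵤ⇒∣ p∣i)) (ℤ∣.∣n⇒∣m*n (X ℤ.^ k) (∣ᵤ⇒∣ p∣j)))

  ∣U-gcd : ∀ {p} i j → p ∣ ∣ U i ∣ → p ∣ ∣ U j ∣ → p ∣ ∣ U (gcd i j) ∣
  ∣U-gcd {p} i j p∣i p∣j with Bézout.identity (gcd-GCD i j)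
  ... | Bézout.+- s t eq = ∣U-difference (s * i) (t * j) (gcd i j) eq (∣U-∣ (n∣m*n s) p∣i) (∣U-∣ (n∣m*n t) p∣j)
  ... | Bézout.-+ s t eq = ∣U-difference (t * j) (s * i) (gcd i j) eq (∣U-∣ (n∣m*n t) p∣j) (∣U-∣ (n∣m*n s) p∣i)

  -- `U (e * q)` is `U e` times a geometric sum that is congruent to `q` modulo `U e`, hence modulo
  -- `p`.
  U-lift : ∀ {p} → Prime p → ∀ e q → p ∤ q → p ∣ ∣ U e ∣ → ∣ U (e * q) ∣ ∼[ p ] ∣ U e ∣
  U-lift {p} pr e q p∤q p∣Ue =
    subst (_∼[ p ] ∣ U e ∣) (sym (trans (cong ∣_∣ factored) (ℤ.abs-* (U e) (geometric y q)))) (*-unit∼ pr p∤geometric)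
    where
    y = X ℤ.^ e
    factored : U (e * q) ≡ U e ℤ.* geometric y q
    factored = trans (cong (λ z → 1ℤ ℤ.- z) (sym (ℤ.^-*-assoc X e q))) (sym (geometric-sum y q))
    p∤geometric : p ∤ ∣ geometric y q ∣
    p∤geometric p∣g = p∤q (∣⇒∣ᵤ {+ p} {+ q} (subst (+ p ∣ℤ_) (lemma (geometric y q) (+ q))
      (ℤ∣.∣m∣n⇒∣m-n {+ p} {geometric y q} (∣ᵤ⇒∣ p∣g) (ℤ∣.∣-trans (∣ᵤ⇒∣ p∣Ue) (geometric-mod y q)))))
      where
      lemma : ∀ g q → g ℤ.- (g ℤ.- q) ≡ q
      lemma = ℤ-Solver.solve-∀

  -- If `p` divided `x`, then `U d` would be 1 modulo `p`.
  ∣U⇒∤x : ∀ {p d} → Prime p → 0 < d → p ∣ ∣ U d ∣ → p ∤ x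
  ∣U⇒∤x {p} {suc d} pr _ p∣U p∣x = prime∤1 pr (∣⇒∣ᵤ {+ p} {1ℤ}
    (ℤ∣.∣m+n∣n⇒∣m {+ p} {1ℤ} {ℤ.- X ℤ.^ suc d} (∣ᵤ⇒∣ p∣U)
      (ℤ∣.∣m⇒∣-m {+ p} {X ℤ.^ suc d} (ℤ∣.∣m⇒∣m*n {+ p} {X} (X ℤ.^ d) (∣ᵤ⇒∣ p∣x)))))

  -- `x * U (p ∸ 1) = x - x ^ p` is a multiple of `p`, and the factor `x` can be cancelled.
  fermat-U : ∀ {p} → Prime p → p ∤ x → p ∣ ∣ U (p ∸ 1) ∣
  fermat-U {p@(suc n)} pr p∤x with fermat pr x
  ... | w , x^p≡ = [ (λ p∣x → contradiction p∣x p∤x) , (λ p∣U → p∣U) ]′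
    (euclidsLemma x ∣ U n ∣ pr (subst (p ∣_) (ℤ.abs-* X (U n)) (∣⇒∣ᵤ {+ p} (ℤ∣.divides (ℤ.- + w) eq))))
    where
    open ≡-Reasoning
    pos-^ : ∀ m → X ℤ.^ m ≡ + (x ^ m)
    pos-^ zero    = refl
    pos-^ (suc m) = trans (cong (X ℤ.*_) (pos-^ m)) (sym (ℤ.pos-* x (x ^ m)))
    lemma₁ : ∀ y z → y ℤ.* (1ℤ ℤ.- z) ≡ y ℤ.- y ℤ.* z
    lemma₁ = ℤ-Solver.solve-∀
    lemma₂ : ∀ y v p → y ℤ.- (y ℤ.+ v ℤ.* p) ≡ (ℤ.- v) ℤ.* p
    lemma₂ = ℤ-Solver.solve-∀
    eq : X ℤ.* U n ≡ (ℤ.- + w) ℤ.* + p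
    eq = begin
      X ℤ.* U n                        ≡⟨ lemma₁ X (X ℤ.^ n) ⟩
      X ℤ.- X ℤ.^ p                    ≡⟨ cong (λ z → X ℤ.- z) (trans (pos-^ p) (cong +_ x^p≡)) ⟩
      X ℤ.- (X ℤ.+ + (w * p))          ≡⟨ cong (λ z → X ℤ.- (X ℤ.+ z)) (ℤ.pos-* w p) ⟩
      X ℤ.- (X ℤ.+ + w ℤ.* + p)        ≡⟨ lemma₂ X (+ w) (+ p) ⟩
      (ℤ.- + w) ℤ.* + p                ∎

  U-nonZero : 1 < x → ∀ {d} → 0 < d → NonZero ∣ U d ∣
  U-nonZero 1<x {suc d} _ = ≢-nonZero λ ∣U∣≡0 →
    <⇒≢ 1<x (sym (∣1⇒≡1 (∣⇒∣ᵤ {X} {1ℤ}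
      (subst (X ∣ℤ_) (sym (ℤ.i-j≡0⇒i≡j 1ℤ (X ℤ.^ suc d) (ℤ.∣i∣≡0⇒i≡0 ∣U∣≡0))) (ℤ∣.∣m⇒∣m*n (X ℤ.^ d) ℤ∣.∣-refl)))))

  -- The products of U (e * s) over the divisors s of product L with an even (E) and
  -- an odd (O) number of missing prime factors, so that E L e / O L e
  -- is a value of the cyclotomic polynomial up to sign.
  mutual
    E : List ℕ → ℕ → ℤ
    E []      e = U e
    E (q ∷ L) e = E L (e * q) ℤ.* O L e

    O : List ℕ → ℕ → ℤ
    O []      e = 1ℤ
    O (q ∷ L) e = O L (e * q) ℤ.* E L e

  module _ (1<x : 1 < x) where
    mutual
      E-nonZero : ∀ {L} → All (0 <_) L → ∀ {e} → 0 < e → NonZero ∣ E L e ∣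
      E-nonZero []           0<e = U-nonZero 1<x 0<e
      E-nonZero {q ∷ L} (0<q ∷ 0<L) {e} 0<e = subst NonZero (sym (ℤ.abs-* (E L (e * q)) (O L e)))
        (m*n≢0 _ _ {{E-nonZero 0<L (*-mono-< 0<e 0<q)}} {{O-nonZero 0<L 0<e}})

      O-nonZero : ∀ {L} → All (0 <_) L → ∀ {e} → 0 < e → NonZero ∣ O L e ∣
      O-nonZero []           0<e = _
      O-nonZero {q ∷ L} (0<q ∷ 0<L) {e} 0<e = subst NonZero (sym (ℤ.abs-* (O L (e * q)) (E L e)))
        (m*n≢0 _ _ {{O-nonZero 0<L (*-mono-< 0<e 0<q)}} {{E-nonZero 0<L 0<e}})

  module _ {p} (pr : Prime p) (r : ℕ) where

    -- Both products consist of factors `U (e * s)` with `s` dividing `product L`, and the shift by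
    -- `r` changes none of them at `p`.
    shift-invariant : ∀ L e → (∀ s → s ∣ product L → ∣ U (e * s * r) ∣ ∼[ p ] ∣ U (e * s) ∣) →
      ∣ E L (e * r) ∣ ∼[ p ] ∣ E L e ∣ × ∣ O L (e * r) ∣ ∼[ p ] ∣ O L e ∣
    shift-invariant []      e hyp =
      subst (λ d → ∣ U (d * r) ∣ ∼[ p ] ∣ U d ∣) (*-identityʳ e) (hyp 1 (1∣ 1)) , ∼-refl pr
    shift-invariant (q ∷ L) e hyp =
      ∼-abs-* pr (E L (e * r * q)) (E L (e * q)) (O L (e * r)) (O L e)
        (subst (λ d → ∣ E L d ∣ ∼[ p ] ∣ E L (e * q) ∣) swapped (proj₁ high)) (proj₂ low) ,
      ∼-abs-* pr (O L (e * r * q)) (O L (e * q)) (E L (e * r)) (E L e)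
        (subst (λ d → ∣ O L d ∣ ∼[ p ] ∣ O L (e * q) ∣) swapped (proj₂ high)) (proj₁ low)
      where
      swapped : e * q * r ≡ e * r * q
      swapped = trans (*-assoc e q r) (trans (cong (e *_) (*-comm q r)) (sym (*-assoc e r q)))
      low  = shift-invariant L e λ s s∣ → hyp s (∣n⇒∣m*n q s∣)
      high = shift-invariant L (e * q) λ s s∣ →
        subst (λ d → ∣ U (d * r) ∣ ∼[ p ] ∣ U d ∣) (sym (*-assoc e q s)) (hyp (q * s) (*-monoʳ-∣ q s∣))

    -- If `r` heads the list, the two products differ only in whether `E` or `O` of the tail is
    -- shifted by `r`, and the shift is invisible at `p`. Any other head reduces to the tail at
    -- `e * q` and at `e`.
    E∼O : ∀ {L} e → r ∈ L → (∀ s → s * r ∣ product L → ∣ U (e * s * r) ∣ ∼[ p ] ∣ U (e * s) ∣) →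
      ∣ E L e ∣ ∼[ p ] ∣ O L e ∣
    E∼O {q ∷ L} e (here refl) hyp
      with shift-invariant L e (λ s s∣ → hyp s (subst (s * r ∣_) (*-comm (product L) r) (*-monoˡ-∣ r s∣)))
    ... | E∼E , O∼O = subst (λ z → ∣ E L (e * r) ℤ.* O L e ∣ ∼[ p ] ∣ z ∣) (ℤ.*-comm (E L e) (O L (e * r)))
      (∼-abs-* pr (E L (e * r)) (E L e) (O L e) (O L (e * r)) E∼E (swap O∼O))
    E∼O {q ∷ L} e (there r∈L) hyp =
      ∼-abs-* pr (E L (e * q)) (O L (e * q)) (O L e) (E L e)
        (E∼O (e * q) r∈L λ s s∣ → subst (λ d → ∣ U (d * r) ∣ ∼[ p ] ∣ U d ∣) (sym (*-assoc e q s))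
          (hyp (q * s) (subst (_∣ q * product L) (sym (*-assoc q s r)) (*-monoʳ-∣ q s∣))))
        (swap (E∼O e r∈L λ s s∣ → hyp s (∣n⇒∣m*n q s∣)))

  module _ (n : ℕ) (0<n : 0 < n) where

    private
      Z = X ℤ.^ suc n

    U-≡1 : ∀ {d} → n < d → U d ≡ 1ℤ [mod Z ]
    U-≡1 n<d with m≤n⇒∃[o]m+o≡n n<d
    ... | o , refl = subst (Z ∣ℤ_) (trans (cong ℤ.-_ (sym (ℤ.^-distribˡ-+-* X (suc n) o))) (lemma (X ℤ.^ (suc n + o))))
      (ℤ∣.∣m⇒∣-m (ℤ∣.∣m⇒∣m*n (X ℤ.^ o) (ℤ∣.∣-refl {Z})))
      where
      lemma : ∀ z → ℤ.- z ≡ (1ℤ ℤ.- z) ℤ.- 1ℤ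
      lemma = ℤ-Solver.solve-∀

    EO-≡1 : ∀ {L} → All (1 <_) L → ∀ {d} → n < d → E L d ≡ 1ℤ [mod Z ] × O L d ≡ 1ℤ [mod Z ]
    EO-≡1 []                  n<d = U-≡1 n<d , mod-refl {1ℤ}
    EO-≡1 {q ∷ L} (1<q ∷ 1<L) {d} n<d =
      mod-* {E L (d * q)} (proj₁ high) (proj₂ low) , mod-* {O L (d * q)} (proj₂ high) (proj₁ low)
      where
      low  = EO-≡1 1<L n<d
      high = EO-≡1 1<L (<-≤-trans n<d (m≤m*n d q {{>-nonZero (<-trans z<s 1<q)}}))

    -- `U n` occurs once, in `E` or in `O` according to the parity of the length of `L`. All other
    -- exponents exceed `n`, so their factors are 1 modulo `Z`.
    EO-smallest : ∀ {L} → All (1 <_) L →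
      (E L n ≡ U n [mod Z ] × O L n ≡ 1ℤ [mod Z ]) ⊎ (O L n ≡ U n [mod Z ] × E L n ≡ 1ℤ [mod Z ])
    EO-smallest [] = inj₁ (mod-refl {U n} , mod-refl {1ℤ})
    EO-smallest {q ∷ L} (1<q ∷ 1<L) with EO-≡1 1<L (m<m*n n q {{>-nonZero 0<n}} 1<q) | EO-smallest 1<L
    ... | E≡1 , O≡1 | inj₁ (E≡U , O≡1′) =
      inj₂ (subst (λ u → O (q ∷ L) n ≡ u [mod Z ]) (ℤ.*-identityˡ (U n)) (mod-* {O L (n * q)} O≡1 E≡U) ,
            mod-* {E L (n * q)} E≡1 O≡1′)
    ... | E≡1 , O≡1 | inj₂ (O≡U , E≡1′) =
      inj₁ (subst (λ u → E (q ∷ L) n ≡ u [mod Z ]) (ℤ.*-identityˡ (U n)) (mod-* {E L (n * q)} E≡1 O≡U) ,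
            mod-* {O L (n * q)} O≡1 E≡1′)

    -- Squaring removes the signs. With `y = x ^ n`, equality would give `x ^ suc n` dividing
    -- `y * (y - 2)`, so `x` would divide `y - 2` and hence 2.
    abs-distinct : 2 < x → ∀ {a b} → a ≡ U n [mod Z ] → b ≡ 1ℤ [mod Z ] → ∣ a ∣ ≢ ∣ b ∣
    abs-distinct 2<x {a} {b} a≡U b≡1 ∣a∣≡∣b∣ = >⇒∤ 2<x (∣⇒∣ᵤ {X} {+ 2} X∣2)
      where
      instance
        X^n≢0 : ℤ.NonZero (X ℤ.^ n)
        X^n≢0 = ℤ.≢-nonZero λ X^n≡0 → >⇒≢ (<-trans z<s 2<x) (ℤ.+-injective (ℤ.i^n≡0⇒i≡0 X n X^n≡0))
      square : ∀ i → i ℤ.* i ≡ + (∣ i ∣ * ∣ i ∣)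
      square (+ k)        = sym (ℤ.pos-* k k)
      square (ℤ.-[1+ k ]) = refl
      a²≡b² : a ℤ.* a ≡ b ℤ.* b
      a²≡b² = trans (square a) (trans (cong (λ k → + (k * k)) ∣a∣≡∣b∣) (sym (square b)))
      lemma₁ : ∀ b y → (b ℤ.- 1ℤ ℤ.* 1ℤ) ℤ.- (b ℤ.- (1ℤ ℤ.- y) ℤ.* (1ℤ ℤ.- y)) ≡ y ℤ.* (y ℤ.- + 2)
      lemma₁ = ℤ-Solver.solve-∀
      X∣X^n-2 : X ∣ℤ X ℤ.^ n ℤ.- + 2
      X∣X^n-2 = ℤ∣.*-cancelˡ-∣ (X ℤ.^ n) (subst₂ _∣ℤ_ (ℤ.*-comm X (X ℤ.^ n)) (lemma₁ (b ℤ.* b) (X ℤ.^ n))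
        (ℤ∣.∣m∣n⇒∣m-n (mod-* {b} b≡1 b≡1) (subst (λ c → c ≡ U n ℤ.* U n [mod Z ]) a²≡b² (mod-* {a} a≡U a≡U))))
      X∣X^n : X ∣ℤ X ℤ.^ n
      X∣X^n = subst (λ k → X ∣ℤ X ℤ.^ k) (suc-pred n {{>-nonZero 0<n}}) (ℤ∣.∣m⇒∣m*n (X ℤ.^ pred n) ℤ∣.∣-refl)
      X∣2 : X ∣ℤ + 2
      X∣2 = subst (X ∣ℤ_) (lemma₂ (X ℤ.^ n)) (ℤ∣.∣m∣n⇒∣m-n X∣X^n X∣X^n-2)
        where
        lemma₂ : ∀ y → y ℤ.- (y ℤ.- + 2) ≡ + 2
        lemma₂ = ℤ-Solver.solve-∀

    ∣E∣≢∣O∣ : 2 < x → ∀ {L} → All (1 <_) L → ∣ E L n ∣ ≢ ∣ O L n ∣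
    ∣E∣≢∣O∣ 2<x {L} 1<L eq with EO-smallest 1<L
    ... | inj₁ (E≡U , O≡1) = abs-distinct 2<x {E L n} {O L n} E≡U O≡1 eq
    ... | inj₂ (O≡U , E≡1) = abs-distinct 2<x {O L n} {E L n} O≡U E≡1 (sym eq)

-- A product of distinct primes is squarefree.
cofactor : ∀ {L q} → All Prime L → Unique L → q ∈ L → ∃ λ M → product L ≡ M * q × q ∤ M
cofactor {q ∷ L} (qr ∷ Lr) (q≢L ∷ _) (here refl) = product L , *-comm q (product L) ,
  λ q∣ → All.lookup q≢L (factorisationHasAllPrimeFactors qr q∣ Lr) refl
cofactor {r ∷ L} {q} (rr ∷ Lr) (r≢L ∷ L!) (there q∈L) with cofactor Lr L! q∈L
... | M , product≡ , q∤M = r * M , trans (cong (r *_) product≡) (sym (*-assoc r M q)) ,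
  prime∤* qr (λ q∣r → All.lookup r≢L q∈L (sym (prime-∣⇒≡ qr rr q∣r))) q∤M
  where qr = All.lookup Lr q∈L

-- By Fermat `p` divides `U (p ∸ 1)`, hence also `U (gcd m (p ∸ 1))`; primitivity forces this gcd to
-- be `m`.
primitive⇒≡1 : ∀ {x m p} → Prime p → 0 < m → p ∣ ∣ U x m ∣ →
  (∀ {d} → d < m → ¬ ((d ∣ m) × (p ∣ ∣ U x d ∣))) → m ∣ p ∸ 1
primitive⇒≡1 {x} {m} {p} pr 0<m p∣U prim with m≤n⇒m<n∨m≡n (∣⇒≤ {{>-nonZero 0<m}} (gcd[m,n]∣m m (p ∸ 1)))
... | inj₂ g≡m = subst (_∣ p ∸ 1) g≡m (gcd[m,n]∣n m (p ∸ 1))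
... | inj₁ g<m = contradiction
  (gcd[m,n]∣m m (p ∸ 1) , ∣U-gcd x m (p ∸ 1) p∣U (fermat-U x pr (∣U⇒∤x x pr 0<m p∣U))) (prim g<m)

module _ (n : ℕ) (0<n : 0 < n) (N : ℕ) where

  private
    -- The bound `3 + n` admits every prime divisor of `n`, and the prime 2 even when `n = 1`, so
    -- `L` is never empty.
    L : List ℕ
    L = filter prime? (upTo (3 + n))

    primes : All Prime L
    primes = all-filter prime? (upTo (3 + n))

    distinct : Unique L
    distinct = filter⁺ prime? (upTo⁺ (3 + n))

    ∈L : ∀ {q} → Prime q → q ≤ 2 + n → q ∈ L
    ∈L qr q≤ = ∈-filter⁺ prime? (∈-upTo⁺ (s≤s q≤)) qr

    1<L : All (1 <_) L
    1<L = All.map (λ {q} qr → nonTrivial⇒n>1 q {{prime⇒nonTrivial qr}}) primes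

    0<L : All (0 <_) L
    0<L = All.map (<-trans z<s) 1<L

    -- The largest of the exponents `n * s` with `s` dividing `product L`; its prime factors all lie
    -- in `L`.
    m = n * product L

    0<m : 0 < m
    0<m = *-mono-< 0<n (productOfPrimes≥1 primes)

    -- Multiples of m and N ! force the primes dividing U m to be
    -- coprime to m and larger than N, and the factor 3 gives 2 < x.
    x = 3 * (m * N !)

    2<x : 2 < x
    2<x = ≤-trans (≤-refl {3}) (m≤m*n 3 (m * N !) {{m*n≢0 m (N !) {{>-nonZero 0<m}} {{N !≢0}}}})

    prime∣m⇒∈L : ∀ {q} → Prime q → q ∣ m → q ∈ L
    prime∣m⇒∈L qr q∣m with euclidsLemma n (product L) qr q∣m
    ... | inj₁ q∣n = ∈L qr (≤-trans (∣⇒≤ {{>-nonZero 0<n}} q∣n) (m≤n+m n 2))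
    ... | inj₂ q∣L = factorisationHasAllPrimeFactors qr q∣L primes

    m∣x : m ∣ x
    m∣x = ∣n⇒∣m*n 3 (m∣m*n (N !))

    -- The bound `d < m` makes the condition decidable by a finite search.
    Primitive : ℕ → Set
    Primitive p = Prime p × (p ∣ ∣ U x m ∣) × ¬ (∃ λ d → d < m × (d ∣ m) × (p ∣ ∣ U x d ∣))

    primitive? : ∀ p → Dec (Primitive p)
    primitive? p = prime? p ×-dec (p ∣? ∣ U x m ∣) ×-dec
      ¬? (anyUpTo? (λ d → (d ∣? m) ×-dec (p ∣? ∣ U x d ∣)) m)

    -- It suffices to find one prime of `L` by which exponents can be multiplied without effect at
    -- `p`. If `p` divides `U d` for a proper divisor `d` of `m`, any prime factor `q` of `m / d`
    -- will do.
    nonPrimitive⇒∼ : ∀ {p} → Prime p → ¬ Primitive p → ∣ E x L n ∣ ∼[ p ] ∣ O x L n ∣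
    nonPrimitive⇒∼ {p} pr ¬primitive with p ∣? ∣ U x m ∣
    -- All the factors are units at `p`, so any member of `L` serves; 2 is always there.
    ... | no p∤U = E∼O x pr 2 n (∈L prime[2] (m≤m+n 2 n)) λ s s2∣ → units∼ pr
      (λ p∣ → p∤U (∣U-∣ x (subst (_∣ m) (sym (*-assoc n s 2)) (*-monoʳ-∣ n s2∣)) p∣))
      (λ p∣ → p∤U (∣U-∣ x (*-monoʳ-∣ n (m*n∣⇒m∣ s 2 s2∣)) p∣))
    ... | yes p∣U with anyUpTo? (λ d → (d ∣? m) ×-dec (p ∣? ∣ U x d ∣)) m
    ...   | no ¬∃ = contradiction (pr , p∣U , ¬∃) ¬primitive
    ...   | yes (d , d<m , divides w m≡wd , p∣Ud)
        with primeDivisor w (λ { refl → >⇒≢ 0<m m≡wd }) (λ { refl → <⇒≢ d<m (sym (trans m≡wd (*-identityˡ d))) })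
    ...     | q , qr , q∣w with prime∣m⇒∈L qr (subst (q ∣_) (sym m≡wd) (∣m⇒∣m*n d q∣w))
    ...       | q∈L with cofactor primes distinct q∈L
    ...         | M , product≡ , q∤M = E∼O x pr q n q∈L go
      where
      instance _ = prime⇒nonZero qr
      m≡nMq : m ≡ n * M * q
      m≡nMq = trans (cong (n *_) product≡) (sym (*-assoc n M q))
      p∤q : p ∤ q
      p∤q p∣q = ∣U⇒∤x x pr 0<m p∣U (∣-trans p∣q (∣-trans (divides (n * M) m≡nMq) m∣x))
      d∣nM : d ∣ n * M
      d∣nM = *-cancelʳ-∣ q (subst₂ _∣_ (*-comm q d) (trans (sym m≡wd) m≡nMq) (*-monoˡ-∣ d q∣w))
      go : ∀ s → s * q ∣ product L → ∣ U x (n * s * q) ∣ ∼[ p ] ∣ U x (n * s) ∣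
      go s sq∣L with p ∣? ∣ U x (n * s) ∣ | *-cancelʳ-∣ q (subst (s * q ∣_) product≡ sq∣L)
      ... | yes p∣Uns | _ = U-lift x pr (n * s) q p∤q p∣Uns
      -- Both values are units: `p` divides `U (n * M)` because `d` divides `n * M`, so if it
      -- divided `U (n * s * q)` it would divide `U` at the gcd of the two exponents, which is
      -- `n * s` because `q` does not divide `t`.
      ... | no p∤Uns | divides t M≡ts = units∼ pr (λ p∣ → p∤Uns (subst (λ k → p ∣ ∣ U x k ∣) gcd≡
          (∣U-gcd x (n * s * q) (n * s * t) p∣ (subst (λ k → p ∣ ∣ U x k ∣) nM≡nst (∣U-∣ x d∣nM p∣Ud))))) p∤Uns
        where
        nM≡nst : n * M ≡ n * s * t
        nM≡nst = trans (cong (n *_) (trans M≡ts (*-comm t s))) (sym (*-assoc n s t))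
        gcd≡ : gcd (n * s * q) (n * s * t) ≡ n * s
        gcd≡ = trans (sym (c*gcd[m,n]≡gcd[cm,cn] (n * s) q t))
          (trans (cong (n * s *_) (Coprime.coprime⇒gcd≡1 (prime-∤⇒coprime qr λ q∣t → q∤M (subst (q ∣_) (sym M≡ts) (∣m⇒∣m*n s q∣t)))))
            (*-identityʳ (n * s)))

  -- A primitive prime divides the nonzero `U m`, so the search up to its absolute value is
  -- exhaustive. If it fails, `E` and `O` divide each other, against `∣E∣≢∣O∣`.
  prime≡1mod : ∃ λ p → Prime p × N < p × n ∣ p ∸ 1
  prime≡1mod with anyUpTo? primitive? (suc ∣ U x m ∣)
  ... | yes (p , _ , pr , p∣U , prim) = p , pr ,
    -- A prime `p ≤ N` divides `N !` and hence `x`.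
    ≰⇒> (λ p≤N → ∣U⇒∤x x pr 0<m p∣U (∣n⇒∣m*n 3 (∣n⇒∣m*n m
      (∣-trans (subst (λ k → k ∣ k !) (suc-pred p {{prime⇒nonZero pr}}) (m∣m*n _)) (m≤n⇒m!∣n! p≤N))))) ,
    ∣-trans (m∣m*n (product L)) (primitive⇒≡1 {x} pr 0<m p∣U λ d<m d∣ → prim (_ , d<m , d∣))
  ... | no ¬∃ = contradiction
    (∣-antisym (≼-everywhere⇒∣ (λ pr → proj₁ (E∼O-all pr))) (≼-everywhere⇒∣ (λ pr → proj₂ (E∼O-all pr))))
    (∣E∣≢∣O∣ x n 0<n 2<x 1<L)
    where
    instance
      U≢0 = U-nonZero x (<-trans (n<1+n 1) 2<x) 0<m
      E≢0 = E-nonZero x (<-trans (n<1+n 1) 2<x) 0<L 0<n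
      O≢0 = O-nonZero x (<-trans (n<1+n 1) 2<x) 0<L 0<n
    E∼O-all : ∀ {p} → Prime p → ∣ E x L n ∣ ∼[ p ] ∣ O x L n ∣
    E∼O-all {p} pr = nonPrimitive⇒∼ pr λ prim →
      ¬∃ (p , s≤s (∣⇒≤ (proj₁ (proj₂ prim))) , prim)

-- Dwork's recursion for rising products

-- risingProduct D α m = D ^ m * (α / D)_m
risingProduct : ℕ → ℕ → ℕ → ℕ
risingProduct D α zero    = 1
risingProduct D α (suc m) = risingProduct D α m * (α + m * D)

risingProduct-∣ : ∀ D α {m n} → m ≤ n → risingProduct D α m ∣ risingProduct D α n
risingProduct-∣ D α {zero}  {n}     z≤n       = 1∣ _
risingProduct-∣ D α {suc m} {suc n} m<n with m≤n⇒m<n∨m≡n (s≤s⁻¹ m<n)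
... | inj₂ refl = ∣-refl
... | inj₁ m<n′ = ∣-trans (risingProduct-∣ D α m<n′) (m∣m*n _)

^-∣ : ∀ x {m n} → m ≤ n → x ^ m ∣ x ^ n
^-∣ x {m} m≤n with m≤n⇒∃[o]m+o≡n m≤n
... | o , refl = subst (x ^ m ∣_) (sym (^-distribˡ-+-* x m o)) (m∣m*n _)

-- α′ / D is Dwork's prime of α / D: p * (α′ / D) - α / D is an integer, and it lies in [0, p).
-- c is the complementary digit p - 1 - i, which spares the truncated subtraction.
record DworkStep (p D α α′ : ℕ) : Set where
  constructor dwork
  field
    {i c} : ℕ
    i+c+1≡p : suc (i + c) ≡ p
    pα′≡    : p * α′ ≡ α + i * D

private
  regroup : ∀ α m i c D → (α + m * D) + suc (i + c) * D ≡ (α + i * D) + (suc m + c) * D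
  regroup = solve-∀

module _ {p D : ℕ} (pr : Prime p) (p∤D : p ∤ D) where

  private instance
    p≢0 : NonZero p
    p≢0 = prime⇒nonZero pr

  -- The factor with index `j` is divisible by `p` exactly when `j` is `i` modulo `p`, and for
  -- `j = i + t * p` it equals `p * (α′ + t * D)`. Below `m` there are `(m + c) / p` such indices;
  -- quotient `μ` and remainder `r` are carried through the induction on `m`.
  peel : ∀ {α α′} (s : DworkStep p D α α′) →
    ∀ m μ r → r < p → m + DworkStep.c s ≡ r + μ * p →
    risingProduct D α m ∼[ p ] p ^ μ * risingProduct D α′ μ
  peel s zero zero r r<p eq = ∼-refl pr
  peel (dwork {i} {c} refl _) zero (suc μ) r r<p eq = contradiction
    (begin-strict
      c                        ≤⟨ m≤n+m c i ⟩
      i + c                    <⟨ n<1+n _ ⟩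
      p                        ≤⟨ m≤m+n p (μ * p) ⟩
      p + μ * p                ≤⟨ m≤n+m _ r ⟩
      r + (p + μ * p)          ≡⟨ eq ⟨
      c                        ∎)
    (<-irrefl refl)
    where open ≤-Reasoning
  -- Nonzero remainder: the last factor is `suc r * D` modulo `p`, a unit.
  peel {α} {α′} s@(dwork {i} {c} refl pα′≡) (suc m) μ (suc r) r<p eq =
    ∼-trans pr (*-unit∼ pr p∤last) (peel s m μ r (<-trans (n<1+n r) r<p) (suc-injective eq))
    where
    total : (α + m * D) + p * D ≡ suc r * D + p * (α′ + μ * D)
    total = begin
      (α + m * D) + suc (i + c) * D                 ≡⟨ regroup α m i c D ⟩
      (α + i * D) + (suc m + c) * D                 ≡⟨ cong₂ _+_ (sym pα′≡) (cong (_* D) eq) ⟩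
      p * α′ + (suc r + μ * p) * D                  ≡⟨ lemma p α′ r μ D ⟩
      suc r * D + p * (α′ + μ * D)                  ∎
      where
      open ≡-Reasoning
      lemma : ∀ p a r μ D → p * a + (suc r + μ * p) * D ≡ suc r * D + p * (a + μ * D)
      lemma = solve-∀
    p∤last : p ∤ α + m * D
    p∤last p∣ = prime∤* pr (>⇒∤ r<p) p∤D (∣m+n∣m⇒∣n
      (subst (p ∣_) (trans total (+-comm (suc r * D) _)) (∣m∣n⇒∣m+n p∣ (m∣m*n D))) (m∣m*n (α′ + μ * D)))
  -- Remainder 0: the last factor is `p * (α′ + μ * D)`, and for `m` factors the remainder is
  -- `i + c`, that is `p - 1`.
  peel {α} {α′} s@(dwork {i} {c} refl pα′≡) (suc m) (suc μ) zero r<p eq =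
    ∼-respʳ pr (lemma₁ (p ^ μ) (risingProduct D α′ μ) p (α′ + μ * D))
      (∼-* pr (peel s m μ (i + c) (n<1+n _) (suc-injective eq))
         (subst (α + m * D ∼[ p ]_) last≡ (∼-refl pr)))
    where
    lemma₁ : ∀ a b p d → a * b * (p * d) ≡ p * a * (b * d)
    lemma₁ = solve-∀
    last≡ : α + m * D ≡ p * (α′ + μ * D)
    last≡ = +-cancelʳ-≡ (p * D) _ _ (begin
      (α + m * D) + suc (i + c) * D                 ≡⟨ regroup α m i c D ⟩
      (α + i * D) + (suc m + c) * D                 ≡⟨ cong₂ _+_ (sym pα′≡) (cong (_* D) eq) ⟩
      p * α′ + (p + μ * p) * D                      ≡⟨ lemma p α′ μ D ⟩
      p * (α′ + μ * D) + p * D                      ∎)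
      where
      open ≡-Reasoning
      lemma : ∀ p a μ D → p * a + (p + μ * p) * D ≡ p * (a + μ * D) + p * D
      lemma = solve-∀

  -- The larger digit of `γ` gives it the smaller quotient `μ ≤ ν`. The induction hypothesis at `μ`
  -- is followed by enlarging `μ` to `ν` on the side of `α`.
  risingProduct-≼ : ∀ {α γ} (s : DworkStep p D α α) (t : DworkStep p D γ γ) →
    DworkStep.i s ≤ DworkStep.i t → 0 < DworkStep.i t →
    ∀ m → risingProduct D γ m ≼[ p ] risingProduct D α m
  risingProduct-≼ {α} {γ} s t i≤j 0<j = <-rec _ go
    where
    open DworkStep s
    open DworkStep t renaming (i to j; c to d; i+c+1≡p to j+d+1≡p) hiding (pα′≡)
    d≤c : d ≤ c
    d≤c = +-cancelˡ-≤ j d c (begin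
      j + d   ≡⟨ suc-injective (trans j+d+1≡p (sym i+c+1≡p)) ⟩
      i + c   ≤⟨ +-monoˡ-≤ c i≤j ⟩
      j + c   ∎)
      where open ≤-Reasoning
    go : ∀ m → (∀ {n} → n < m → risingProduct D γ n ≼[ p ] risingProduct D α n) →
      risingProduct D γ m ≼[ p ] risingProduct D α m
    go zero      rec = ∣⇒≼ pr ∣-refl
    go m@(suc n) rec =
      ≼-trans pr (proj₁ (peel t m μ ((m + d) % p) (m%n<n (m + d) p) (m≡m%n+[m/n]*n (m + d) p)))
        (≼-trans pr
          (≼-* pr (∣⇒≼ pr (^-∣ p μ≤ν))
            (≼-trans pr (rec (m<n*o⇒m/o<n m+d<mp)) (∣⇒≼ pr (risingProduct-∣ D α μ≤ν))))
          (proj₂ (peel s m ν ((m + c) % p) (m%n<n (m + c) p) (m≡m%n+[m/n]*n (m + c) p))))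
      where
      μ = (m + d) / p
      ν = (m + c) / p
      μ≤ν : μ ≤ ν
      μ≤ν = /-monoˡ-≤ p (+-monoʳ-≤ m d≤c)
      -- This yields `μ < m`. For digit `j = 0` it would fail at `m = 1`, where `d = p - 1`.
      m+d<mp : m + d < m * p
      m+d<mp = begin-strict
        m + d       ≡⟨ +-comm m d ⟩
        d + m       ≡⟨ +-suc d n ⟩
        suc d + n   ≤⟨ +-mono-≤ (+-monoˡ-≤ d 0<j) (m≤m*n n p) ⟩
        j + d + n * p  <⟨ n<1+n _ ⟩
        suc (j + d) + n * p  ≡⟨ cong (_+ n * p) j+d+1≡p ⟩
        p + n * p ∎
        where open ≤-Reasoning

  data DworkSteps : ℕ → ℕ → ℕ → Set where
    []  : ∀ {α} → DworkSteps 0 α α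
    _∷_ : ∀ {k α α′ α″} → DworkStep p D α α′ → DworkSteps k α′ α″ → DworkSteps (suc k) α α″

  -- Free of `α`: at a length divisible by `p` the remainder is `c` itself, and the quotient is the
  -- same for every digit.
  peeled : ℕ → ℕ → ℕ
  peeled zero    μ = 1
  peeled (suc k) μ = p ^ (p ^ k * μ) * peeled k μ

  peel-steps : ∀ {k α α″} → DworkSteps k α α″ → ∀ μ →
    risingProduct D α (p ^ k * μ) ∼[ p ] peeled k μ * risingProduct D α″ μ
  peel-steps {zero} {α} [] μ =
    subst₂ (λ m n → risingProduct D α m ∼[ p ] n)
      (sym (*-identityˡ μ)) (sym (*-identityˡ (risingProduct D α μ))) (∼-refl pr)
  peel-steps {suc k} {α} {α″} (_∷_ {α′ = α′} s ss) μ =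
    subst (risingProduct D α (p ^ suc k * μ) ∼[ p ]_)
      (sym (*-assoc (p ^ (p ^ k * μ)) (peeled k μ) (risingProduct D α″ μ)))
      (∼-trans pr
        (peel s (p ^ suc k * μ) (p ^ k * μ) c c<p (trans (+-comm _ c) (cong (λ x → c + x) (trans (*-assoc p (p ^ k) μ) (*-comm p (p ^ k * μ))))))
        (∼-*ˡ pr (p ^ (p ^ k * μ)) (peel-steps ss μ)))
    where
    open DworkStep s
    c<p : c < p
    c<p = subst (c <_) i+c+1≡p (s≤s (m≤n+m c i))

  module _ {k d : ℕ} where

    private
      peeledTo : ℕ → ℕ
      peeledTo ν = peeled k (d + ν * p) * p ^ ν
      next : ℕ → ℕ
      next ν = p ^ k * (d + ν * p)

    -- The last of the `k + 1` steps is kept apart because its digit alone is compared with `d`.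
    record Cycle (α : ℕ) : Set where
      field
        {penultimate} : ℕ
        initial       : DworkSteps k α penultimate
        last          : DworkStep p D penultimate α
      open DworkStep last public using (i; c; i+c+1≡p)

    -- In the last step `d + c ≤ i + c < p` is still a remainder, so the quotient is `ν`.
    peel-low : ∀ {α} (s : Cycle α) → d ≤ Cycle.i s → ∀ ν →
      risingProduct D α (next ν) ∼[ p ] peeledTo ν * risingProduct D α ν
    peel-low {α} s d≤i ν = ∼-respʳ pr (sym (*-assoc (peeled k (d + ν * p)) (p ^ ν) _))
      (∼-trans pr (peel-steps initial _) (∼-*ˡ pr (peeled k (d + ν * p))
        (peel last (d + ν * p) ν (d + c) (subst (d + c <_) i+c+1≡p (s≤s (+-monoˡ-≤ c d≤i)))
          (lemma d ν p c))))
      where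
      open Cycle s
      lemma : ∀ d ν p c → d + ν * p + c ≡ d + c + ν * p
      lemma = solve-∀

    -- With `d = suc i + e` the last step has `d + c = e + p`: a carry, so the quotient is `suc ν`
    -- and one more `p` comes off.
    peel-high : ∀ {γ} (s : Cycle γ) → Cycle.i s < d → d < p → ∀ ν →
      risingProduct D γ (next ν) ∼[ p ] peeledTo ν * (p * risingProduct D γ (suc ν))
    peel-high {γ} s i<d d<p ν with m≤n⇒∃[o]m+o≡n i<d
    ... | e , 1+i+e≡d =
      ∼-respʳ pr (lemma₂ (peeled k (d + ν * p)) p (p ^ ν) (risingProduct D γ (suc ν)))
      (∼-trans pr (peel-steps initial _) (∼-*ˡ pr (peeled k (d + ν * p))
        (peel last (d + ν * p) (suc ν) e (≤-<-trans (subst (e ≤_) 1+i+e≡d (m≤n+m e (suc i))) d<p)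
          (trans (cong (λ x → x + ν * p + c) (sym 1+i+e≡d))
            (trans (lemma i e (ν * p) c) (cong (λ x → e + (x + ν * p)) i+c+1≡p))))))
      where
      open Cycle s
      lemma : ∀ i e x c → suc (i + e) + x + c ≡ e + (suc (i + c) + x)
      lemma = solve-∀
      lemma₂ : ∀ a p b r → a * (p * b * r) ≡ a * b * (p * r)
      lemma₂ = solve-∀

    -- Induction on `R`: in passing from `ν` to `next ν` both sides gain `peeledTo ν` twice, and the
    -- carry in `γ` supplies the additional `p`.
    unbounded : ∀ {α β γ} (a : Cycle α) (b : Cycle β) (c : Cycle γ) (e : Cycle D) →
      d ≤ Cycle.i a → d ≤ Cycle.i b → Cycle.i c < d → d ≤ Cycle.i e →
      ∀ R → ∃ λ m → p ^ R * (risingProduct D α m * risingProduct D β m)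
                    ≼[ p ] risingProduct D γ m * risingProduct D D m
    unbounded a b c e a≥ b≥ c< e≥ zero = 0 , ∣⇒≼ pr ∣-refl
    unbounded {α} {β} {γ} a b c e a≥ b≥ c< e≥ (suc R) with unbounded a b c e a≥ b≥ c< e≥ R
    ... | ν , rec = next ν ,
      ≼-trans pr (≼-*ˡ pr (p ^ suc R) (≼-* pr (proj₁ (peel-low a a≥ ν)) (proj₁ (peel-low b b≥ ν))))
        (subst (_≼[ p ] Q γ (next ν) * Q D (next ν)) (sym (lemma₁ p (p ^ R) (peeledTo ν) (Q α ν) (Q β ν)))
        (≼-trans pr (≼-*ˡ pr (peeledTo ν * peeledTo ν * p) rec)
        (subst (_≼[ p ] Q γ (next ν) * Q D (next ν)) (sym (lemma₂ p (peeledTo ν) (Q γ ν) (Q D ν)))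
        (≼-* pr
          -- The additional factor of `Q γ (suc ν)` over `Q γ ν` is dropped.
          (≼-trans pr (∣⇒≼ pr (*-monoʳ-∣ (peeledTo ν) (*-monoʳ-∣ p (m∣m*n _)))) (proj₂ (peel-high c c< d<p ν)))
          (proj₂ (peel-low e e≥ ν))))))
      where
      Q = risingProduct D
      d<p : d < p
      d<p = ≤-<-trans a≥ (subst (Cycle.i a <_) (Cycle.i+c+1≡p a) (s≤s (m≤m+n _ _)))
      lemma₁ : ∀ p r c x y → p * r * (c * x * (c * y)) ≡ c * c * p * (r * (x * y))
      lemma₁ = solve-∀
      lemma₂ : ∀ p c x y → c * c * p * (x * y) ≡ c * (p * x) * (c * y)
      lemma₂ = solve-∀

-- Periods and digits of Dwork's map

%≡⇒∣∸ : ∀ m n D .{{_ : NonZero D}} → m % D ≡ n % D → D ∣ m ∸ n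
%≡⇒∣∸ m n D eq = divides (m / D ∸ n / D) (begin
  m ∸ n                                      ≡⟨ cong₂ _∸_ (m≡m%n+[m/n]*n m D) (m≡m%n+[m/n]*n n D) ⟩
  (m % D + m / D * D) ∸ (n % D + n / D * D)  ≡⟨ cong (λ r → (r + m / D * D) ∸ (n % D + n / D * D)) eq ⟩
  (n % D + m / D * D) ∸ (n % D + n / D * D)  ≡⟨ [m+n]∸[m+o]≡n∸o (n % D) _ _ ⟩
  m / D * D ∸ n / D * D                      ≡⟨ *-distribʳ-∸ D (m / D) (n / D) ⟨
  (m / D ∸ n / D) * D                        ∎)
  where open ≡-Reasoning

-- Two of the `D + 1` powers with exponents 0 to `D` agree modulo `D`, and the smaller one can be
-- cancelled.
∃-power≡1 : ∀ {D x} .{{_ : NonZero D}} → Coprime D x → ∃ λ k → D ∣ x ^ suc k ∸ 1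
∃-power≡1 {D} {x} D⊥x with pigeonhole (n<1+n D) (λ i → (x ^ toℕ i) mod D)
... | i , j , i<j , eq with m≤n⇒∃[o]m+o≡n i<j
...   | k , 1+i+k≡j = k , coprime-divisor (coprime-^ʳ (toℕ i) D⊥x)
  (subst (D ∣_) factored (%≡⇒∣∸ (x ^ toℕ j) (x ^ toℕ i) D (begin
    x ^ toℕ j % D         ≡⟨ toℕ-fromℕ< (m%n<n (x ^ toℕ j) D) ⟨
    toℕ (x ^ toℕ j mod D) ≡⟨ cong toℕ eq ⟨
    toℕ (x ^ toℕ i mod D) ≡⟨ toℕ-fromℕ< (m%n<n (x ^ toℕ i) D) ⟩
    x ^ toℕ i % D         ∎)))
  where
  open ≡-Reasoning
  factored : x ^ toℕ j ∸ x ^ toℕ i ≡ x ^ toℕ i * (x ^ suc k ∸ 1)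
  factored = begin
    x ^ toℕ j ∸ x ^ toℕ i                       ≡⟨ cong (λ e → x ^ e ∸ x ^ toℕ i) (trans (+-suc (toℕ i) k) 1+i+k≡j) ⟨
    x ^ (toℕ i + suc k) ∸ x ^ toℕ i             ≡⟨ cong₂ _∸_ (^-distribˡ-+-* x (toℕ i) (suc k)) (sym (*-identityʳ (x ^ toℕ i))) ⟩
    x ^ toℕ i * x ^ suc k ∸ x ^ toℕ i * 1       ≡⟨ *-distribˡ-∸ (x ^ toℕ i) _ 1 ⟨
    x ^ toℕ i * (x ^ suc k ∸ 1)                 ∎

dworkStep : ∀ {p D α α′} i → i < p → p * α′ ≡ α + i * D → DworkStep p D α α′
dworkStep {p} i i<p eq = record { i = i ; c = p ∸ suc i ; i+c+1≡p = m+[n∸m]≡n i<p ; pα′≡ = eq }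

module _ {p D : ℕ} (pr : Prime p) .{{_ : NonZero D}} where

  module _ (p∤D : p ∤ D) where

    residue : ∀ α j → ℕ
    residue α j = (p ^ j * α) % D

    *α/D<p : ∀ {α} → α < D → p * α / D < p
    *α/D<p α<D = m<n*o⇒m/o<n (*-monoʳ-< p {{prime⇒nonZero pr}} α<D)

    -- Dwork's map divides by `p` modulo `D`, so it runs through the residues of `p ^ j * α`
    -- backwards.
    residue-step : ∀ α j → DworkStep p D (residue α (suc j)) (residue α j)
    residue-step α j = dworkStep (p * residue α j / D) (*α/D<p (m%n<n (p ^ j * α) D))
      (trans (m≡m%n+[m/n]*n (p * residue α j) D) (cong (_+ (p * residue α j / D) * D) (sym residue-suc)))
      where
      open ≡-Reasoning
      residue-suc : residue α (suc j) ≡ p * residue α j % D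
      residue-suc = begin
        p * p ^ j * α % D                        ≡⟨ cong (_% D) (*-assoc p (p ^ j) α) ⟩
        p * (p ^ j * α) % D                      ≡⟨ %-distribˡ-* p (p ^ j * α) D ⟩
        (p % D) * ((p ^ j * α) % D) % D          ≡⟨ cong (λ x → (p % D) * x % D) (m%n%n≡m%n (p ^ j * α) D) ⟨
        (p % D) * (p ^ j * α % D % D) % D        ≡⟨ %-distribˡ-* p (p ^ j * α % D) D ⟨
        p * (p ^ j * α % D) % D                  ∎

    residue-steps : ∀ α k j → DworkSteps pr p∤D k (residue α (k + j)) (residue α j)
    residue-steps α zero    j = []
    residue-steps α (suc k) j = residue-step α (k + j) ∷ residue-steps α k j

    -- As `p ^ suc k` is 1 modulo `D`, the residue with index `k + 1` is `α` again; the steps lead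
    -- from there down to index 0, the last one having digit `p * α / D`.
    cycle : ∀ {k d α} → D ∣ p ^ suc k ∸ 1 → α < D → Cycle pr p∤D {k} {d} α
    cycle {k} {d} {α} (divides q p^k-1≡qD) α<D = record
      { penultimate = p * α % D
      ; initial     = subst₂ (DworkSteps pr p∤D k) full≡α (cong (λ x → x * α % D) (*-identityʳ p)) (residue-steps α k 1)
      ; last        = dworkStep (p * α / D) (*α/D<p α<D) (m≡m%n+[m/n]*n (p * α) D)
      }
      where
      open ≡-Reasoning
      p^≡ : p ^ suc k ≡ 1 + q * D
      p^≡ = trans (sym (m+[n∸m]≡n (m^n>0 p {{prime⇒nonZero pr}} (suc k)))) (cong suc p^k-1≡qD)
      full≡α : residue α (k + 1) ≡ α
      full≡α = begin
        p ^ (k + 1) * α % D        ≡⟨ cong (λ e → p ^ e * α % D) (+-comm k 1) ⟩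
        p ^ suc k * α % D          ≡⟨ cong (λ x → x * α % D) p^≡ ⟩
        (1 + q * D) * α % D        ≡⟨ cong (_% D) (lemma q D α) ⟩
        (α + q * α * D) % D        ≡⟨ [m+kn]%n≡m%n α (q * α) D ⟩
        α % D                      ≡⟨ m<n⇒m%n≡m α<D ⟩
        α                          ∎
        where
        lemma : ∀ q D α → (1 + q * D) * α ≡ α + q * α * D
        lemma = solve-∀

    -- The parameter 1 = D / D of the factorial is fixed by every Dwork step, with digit p - 1.
    cycle-one : ∀ {k d} → Cycle pr p∤D {k} {d} D
    cycle-one {k} = record { initial = steps k ; last = step }
      where
      step : DworkStep p D D D
      step = dworkStep (pred p) (≤-reflexive suc-pred-p) (cong (_* D) (sym suc-pred-p))
        where suc-pred-p = suc-pred p {{prime⇒nonZero pr}}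
      steps : ∀ k → DworkSteps pr p∤D k D D
      steps zero    = []
      steps (suc k) = step ∷ steps k

  ratio-unbounded : ∀ {α β γ} → D < p → α < D → β < D → γ < α → γ < β →
    ∀ R → ∃ λ m → p ^ R * (risingProduct D α m * risingProduct D β m)
                  ≼[ p ] risingProduct D γ m * risingProduct D D m
  ratio-unbounded {α} {β} {γ} D<p α<D β<D γ<α γ<β with ∃-power≡1 (Coprime.sym (prime-∤⇒coprime pr (>⇒∤ D<p)))
  -- `d` is the digit of `γ` plus 1. It is at most the digits of `α` and `β` because `D < p`
  -- separates the digits of distinct numerators, and at most `p - 1`, the digit of `D`.
  ... | k , D∣ = unbounded pr p∤D {k} {suc (p * γ / D)}
    (cycle p∤D D∣ α<D) (cycle p∤D D∣ β<D) (cycle p∤D D∣ (<-trans γ<α α<D)) (cycle-one p∤D)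
    (digit< γ<α) (digit< γ<β) ≤-refl (pred-mono-≤ (≤-trans (s≤s (digit< γ<α)) (*α/D<p p∤D α<D)))
    where
    p∤D : p ∤ D
    p∤D = >⇒∤ D<p
    digit< : ∀ {δ} → γ < δ → p * γ / D < p * δ / D
    digit< {δ} γ<δ = begin
      1 + p * γ / D        ≡⟨ +-comm 1 _ ⟩
      p * γ / D + 1        ≡⟨ cong (λ x → p * γ / D + x) (n/n≡1 D) ⟨
      p * γ / D + D / D    ≡⟨ +-distrib-/-∣ʳ (p * γ) ∣-refl ⟨
      (p * γ + D) / D      ≤⟨ /-monoˡ-≤ D (+-monoʳ-≤ (p * γ) (<⇒≤ D<p)) ⟩
      (p * γ + p) / D      ≡⟨ cong (_/ D) (trans (+-comm (p * γ) p) (sym (*-suc p γ))) ⟩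
      p * suc γ / D        ≤⟨ /-monoˡ-≤ D (*-monoʳ-≤ p γ<δ) ⟩
      p * δ / D            ∎
      where open ≤-Reasoning

  -- With `p = suc (h * D)` every `δ ≤ D` is fixed by Dwork's map, with digit `δ * h`, which
  -- increases with `δ`.
  risingProduct-≼-1modD : ∀ {α γ} → D ∣ p ∸ 1 → 0 < α → α ≤ γ → γ ≤ D →
    ∀ m → risingProduct D γ m ≼[ p ] risingProduct D α m
  risingProduct-≼-1modD {α} {γ} (divides h p-1≡hD) 0<α α≤γ γ≤D =
    risingProduct-≼ pr (>⇒∤ D<p) (fixed (≤-trans α≤γ γ≤D)) (fixed γ≤D)
      (*-monoˡ-≤ h α≤γ) (*-mono-≤ (≤-trans 0<α α≤γ) 0<h)
    where
    p≡ : p ≡ suc (h * D)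
    p≡ = trans (sym (m+[n∸m]≡n (>-nonZero⁻¹ p {{prime⇒nonZero pr}}))) (cong suc p-1≡hD)
    0<h : 0 < h
    0<h = n≢0⇒n>0 λ { refl → ¬prime[1] (subst Prime p≡ pr) }
    D<p : D < p
    D<p = subst (D <_) (sym p≡) (s≤s (m≤n*m D h {{>-nonZero 0<h}}))
    fixed : ∀ {δ} → δ ≤ D → DworkStep p D δ δ
    fixed {δ} δ≤D = dworkStep (δ * h)
      (subst (δ * h <_) (sym p≡) (s≤s (subst (δ * h ≤_) (*-comm D h) (*-monoˡ-≤ h δ≤D))))
      (trans (cong (_* δ) p≡) (lemma h D δ))
      where
      lemma : ∀ h D δ → suc (h * D) * δ ≡ δ + δ * h * D
      lemma = solve-∀

-- Clearing denominators

ℕ→ℚ-canonical : ∀ n → ℕ→ℚ n ≡ mkℚ (+ n) 0 (λ (_ , d∣1) → ∣1⇒≡1 d∣1)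
ℕ→ℚ-canonical n = ℚ.normalize-coprime _

toℚᵘ-ℕ→ℚ : ∀ n → toℚᵘ (ℕ→ℚ n) ≡ mkℚᵘ (+ n) 0
toℚᵘ-ℕ→ℚ n = cong toℚᵘ (ℕ→ℚ-canonical n)

ℕ→ℚ-* : ∀ m n → ℕ→ℚ (m * n) ≡ ℕ→ℚ m ℚ.* ℕ→ℚ n
ℕ→ℚ-* m n = ℚ.toℚᵘ-injective (ℚᵘ.≃-sym (ℚᵘ.≃-trans (ℚ.toℚᵘ-homo-* (ℕ→ℚ m) (ℕ→ℚ n)) eq))
  where
  eq : toℚᵘ (ℕ→ℚ m) ℚᵘ.* toℚᵘ (ℕ→ℚ n) ℚᵘ.≃ toℚᵘ (ℕ→ℚ (m * n))
  eq rewrite toℚᵘ-ℕ→ℚ m | toℚᵘ-ℕ→ℚ n | toℚᵘ-ℕ→ℚ (m * n) = *≡* (cong (ℤ._* + 1) (sym (ℤ.pos-* m n)))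

ℕ→ℚ-+ : ∀ m n → ℕ→ℚ (m + n) ≡ ℕ→ℚ m ℚ.+ ℕ→ℚ n
ℕ→ℚ-+ m n = ℚ.toℚᵘ-injective (ℚᵘ.≃-sym (ℚᵘ.≃-trans (ℚ.toℚᵘ-homo-+ (ℕ→ℚ m) (ℕ→ℚ n)) eq))
  where
  eq : toℚᵘ (ℕ→ℚ m) ℚᵘ.+ toℚᵘ (ℕ→ℚ n) ℚᵘ.≃ toℚᵘ (ℕ→ℚ (m + n))
  eq rewrite toℚᵘ-ℕ→ℚ m | toℚᵘ-ℕ→ℚ n | toℚᵘ-ℕ→ℚ (m + n) =
    *≡* (cong (ℤ._* + 1) (cong₂ ℤ._+_ (ℤ.*-identityʳ (+ m)) (ℤ.*-identityʳ (+ n))))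

ℕ→ℚ-mono-< : ∀ {m n} → m < n → ℕ→ℚ m <ℚ ℕ→ℚ n
ℕ→ℚ-mono-< {m} {n} m<n rewrite ℕ→ℚ-canonical m | ℕ→ℚ-canonical n =
  *<* (subst₂ ℤ._<_ (sym (ℤ.*-identityʳ (+ m))) (sym (ℤ.*-identityʳ (+ n))) (+<+ m<n))

ℕ→ℚ-cancel-< : ∀ {m n} → ℕ→ℚ m <ℚ ℕ→ℚ n → m < n
ℕ→ℚ-cancel-< {m} {n} m<n rewrite ℕ→ℚ-canonical m | ℕ→ℚ-canonical n =
  ℤ.drop‿+<+ (subst₂ ℤ._<_ (ℤ.*-identityʳ (+ m)) (ℤ.*-identityʳ (+ n)) (ℚ.drop-*<* m<n))

ℕ→ℚ-injective : ∀ {m n} → ℕ→ℚ m ≡ ℕ→ℚ n → m ≡ n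
ℕ→ℚ-injective {m} {n} eq = ℤ.+-injective
  (cong ↥_ (trans (sym (ℕ→ℚ-canonical m)) (trans eq (ℕ→ℚ-canonical n))))

cross-multiply : ∀ q m n → q ℚ.* ℕ→ℚ m ≡ ℕ→ℚ n → ∣ ↥ q ∣ * m ≡ n * ↧ₙ q
cross-multiply q@record{} m n eq with ℚᵘ.≃-trans (ℚᵘ.≃-sym (ℚ.toℚᵘ-homo-* q (ℕ→ℚ m))) (ℚ.toℚᵘ-cong eq)
... | eq′ rewrite toℚᵘ-ℕ→ℚ m | toℚᵘ-ℕ→ℚ n with eq′
...   | *≡* e = begin
  ∣ ↥ q ∣ * m                     ≡⟨ ℤ.abs-* (↥ q) (+ m) ⟨
  ∣ ↥ q ℤ.* + m ∣                 ≡⟨ cong ∣_∣ (ℤ.*-identityʳ (↥ q ℤ.* + m)) ⟨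
  ∣ ↥ q ℤ.* + m ℤ.* + 1 ∣         ≡⟨ cong ∣_∣ e ⟩
  ∣ + n ℤ.* + (↧ₙ q * 1) ∣        ≡⟨ ℤ.abs-* (+ n) (+ (↧ₙ q * 1)) ⟩
  n * (↧ₙ q * 1)                  ≡⟨ cong (n *_) (*-identityʳ (↧ₙ q)) ⟩
  n * ↧ₙ q                        ∎
  where open ≡-Reasoning

-- `n / D` need not be in lowest terms, so that one `D` can serve all parameters.
record _HasNumerator_Over_ (q : ℚ) (n D : ℕ) : Set where
  constructor cleared
  field
    q*D≡n : q ℚ.* ℕ→ℚ D ≡ ℕ→ℚ n

clear-denominator : ∀ {q D} → 0ℚ <ℚ q → ↧ₙ q ∣ D → ∃ λ n → q HasNumerator n Over D
clear-denominator {mkℚ -[1+ _ ] _ _} (*<* ())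
clear-denominator {q@(mkℚ (+ n) d-1 _)} 0<q (divides e refl) = e * n ,
  cleared (ℚ.toℚᵘ-injective (ℚᵘ.≃-trans (ℚ.toℚᵘ-homo-* q (ℕ→ℚ (e * suc d-1))) eq))
  where
  eq : toℚᵘ q ℚᵘ.* toℚᵘ (ℕ→ℚ (e * suc d-1)) ℚᵘ.≃ toℚᵘ (ℕ→ℚ (e * n))
  eq rewrite toℚᵘ-ℕ→ℚ (e * suc d-1) | toℚᵘ-ℕ→ℚ (e * n) = *≡* (begin
    + n ℤ.* + (e * suc d-1) ℤ.* + 1   ≡⟨ cong (ℤ._* + 1) (ℤ.pos-* n (e * suc d-1)) ⟨
    + (n * (e * suc d-1)) ℤ.* + 1     ≡⟨ ℤ.*-identityʳ _ ⟩
    + (n * (e * suc d-1))             ≡⟨ cong +_ (lemma n e (suc d-1)) ⟩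
    + (e * n * (suc d-1 * 1))         ≡⟨ ℤ.pos-* (e * n) (suc d-1 * 1) ⟩
    + (e * n) ℤ.* + (suc d-1 * 1)     ∎)
    where
    open ≡-Reasoning
    lemma : ∀ n e d → n * (e * d) ≡ e * n * (d * 1)
    lemma = solve-∀

⊘-* : ∀ x {y} → y ≢ 0ℚ → (x ⊘ y) ℚ.* y ≡ x
⊘-* x {y} y≢0 with y ℚ.≟ 0ℚ
... | yes y≡0 = contradiction y≡0 y≢0
... | no y≢0′ = trans (ℚ.*-assoc x (ℚ.1/ y) y) (trans (cong (x ℚ.*_) (ℚ.*-inverseˡ y)) (ℚ.*-identityʳ x))
  where instance _ = ℚ.≢-nonZero y≢0′

poch-clear : ∀ {a D α} → a HasNumerator α Over D →
  ∀ m → poch a m ℚ.* ℕ→ℚ (D ^ m) ≡ ℕ→ℚ (risingProduct D α m)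
poch-clear _ zero = refl
poch-clear {a} {D} {α} a≡α/D@(cleared a*D≡α) (suc m) = begin
  poch a m ℚ.* (a ℚ.+ ℕ→ℚ m) ℚ.* ℕ→ℚ (D * D ^ m)
    ≡⟨ cong (poch a m ℚ.* (a ℚ.+ ℕ→ℚ m) ℚ.*_) (trans (cong ℕ→ℚ (*-comm D (D ^ m))) (ℕ→ℚ-* (D ^ m) D)) ⟩
  poch a m ℚ.* (a ℚ.+ ℕ→ℚ m) ℚ.* (ℕ→ℚ (D ^ m) ℚ.* ℕ→ℚ D)
    ≡⟨ *-interchange (poch a m) _ _ _ ⟩
  poch a m ℚ.* ℕ→ℚ (D ^ m) ℚ.* ((a ℚ.+ ℕ→ℚ m) ℚ.* ℕ→ℚ D)
    ≡⟨ cong₂ ℚ._*_ (poch-clear a≡α/D m) last ⟩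
  ℕ→ℚ (risingProduct D α m) ℚ.* ℕ→ℚ (α + m * D)
    ≡⟨ ℕ→ℚ-* (risingProduct D α m) (α + m * D) ⟨
  ℕ→ℚ (risingProduct D α m * (α + m * D)) ∎
  where
  open ≡-Reasoning
  last : (a ℚ.+ ℕ→ℚ m) ℚ.* ℕ→ℚ D ≡ ℕ→ℚ (α + m * D)
  last = begin
    (a ℚ.+ ℕ→ℚ m) ℚ.* ℕ→ℚ D                ≡⟨ ℚ.*-distribʳ-+ (ℕ→ℚ D) a (ℕ→ℚ m) ⟩
    a ℚ.* ℕ→ℚ D ℚ.+ ℕ→ℚ m ℚ.* ℕ→ℚ D        ≡⟨ cong₂ ℚ._+_ a*D≡α (sym (ℕ→ℚ-* m D)) ⟩
    ℕ→ℚ α ℚ.+ ℕ→ℚ (m * D)                  ≡⟨ ℕ→ℚ-+ α (m * D) ⟨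
    ℕ→ℚ (α + m * D)                        ∎

-- `m !` is the rising factorial of 1 = `D / D`.
!-clear : ∀ D m → m ! * D ^ m ≡ risingProduct D D m
!-clear D zero    = refl
!-clear D (suc m) = trans (lemma m (m !) D (D ^ m)) (cong (_* (D + m * D)) (!-clear D m))
  where
  lemma : ∀ m f D e → suc m * f * (D * e) ≡ f * e * (D + m * D)
  lemma = solve-∀

risingProduct-nonZero : ∀ D {α} → 0 < α → ∀ m → NonZero (risingProduct D α m)
risingProduct-nonZero D 0<α zero    = _
risingProduct-nonZero D {α} 0<α (suc m) =
  m*n≢0 (risingProduct D α m) (α + m * D) {{risingProduct-nonZero D 0<α m}} {{>-nonZero (≤-trans 0<α (m≤m+n α (m * D)))}}

-- Numerator and denominator contain two rising factorials each, so the powers of `D` cancel.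
coeff-clear : ∀ {a b c D α β γ} .{{_ : NonZero D}} → 0 < γ →
  a HasNumerator α Over D → b HasNumerator β Over D → c HasNumerator γ Over D → ∀ m →
  coeff a b c m ℚ.* ℕ→ℚ (risingProduct D γ m * risingProduct D D m)
    ≡ ℕ→ℚ (risingProduct D α m * risingProduct D β m)
coeff-clear {a} {b} {c} {D} {α} {β} {γ} 0<γ a≡ b≡ c≡ m = begin
  coeff a b c m ℚ.* ℕ→ℚ (risingProduct D γ m * risingProduct D D m)
    ≡⟨ cong (coeff a b c m ℚ.*_) denominator ⟨
  coeff a b c m ℚ.* (poch c m ℚ.* ℕ→ℚ (m !) ℚ.* (ℕ→ℚ (D ^ m) ℚ.* ℕ→ℚ (D ^ m)))
    ≡⟨ ℚ.*-assoc (coeff a b c m) _ _ ⟨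
  coeff a b c m ℚ.* (poch c m ℚ.* ℕ→ℚ (m !)) ℚ.* (ℕ→ℚ (D ^ m) ℚ.* ℕ→ℚ (D ^ m))
    ≡⟨ cong (ℚ._* (ℕ→ℚ (D ^ m) ℚ.* ℕ→ℚ (D ^ m))) (⊘-* (poch a m ℚ.* poch b m) denominator≢0) ⟩
  poch a m ℚ.* poch b m ℚ.* (ℕ→ℚ (D ^ m) ℚ.* ℕ→ℚ (D ^ m))
    ≡⟨ *-interchange (poch a m) _ _ _ ⟩
  poch a m ℚ.* ℕ→ℚ (D ^ m) ℚ.* (poch b m ℚ.* ℕ→ℚ (D ^ m))
    ≡⟨ cong₂ ℚ._*_ (poch-clear a≡ m) (poch-clear b≡ m) ⟩
  ℕ→ℚ (risingProduct D α m) ℚ.* ℕ→ℚ (risingProduct D β m)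
    ≡⟨ ℕ→ℚ-* (risingProduct D α m) (risingProduct D β m) ⟨
  ℕ→ℚ (risingProduct D α m * risingProduct D β m) ∎
  where
  open ≡-Reasoning
  denominator : poch c m ℚ.* ℕ→ℚ (m !) ℚ.* (ℕ→ℚ (D ^ m) ℚ.* ℕ→ℚ (D ^ m))
                ≡ ℕ→ℚ (risingProduct D γ m * risingProduct D D m)
  denominator = begin
    poch c m ℚ.* ℕ→ℚ (m !) ℚ.* (ℕ→ℚ (D ^ m) ℚ.* ℕ→ℚ (D ^ m))
      ≡⟨ *-interchange (poch c m) _ _ _ ⟩
    poch c m ℚ.* ℕ→ℚ (D ^ m) ℚ.* (ℕ→ℚ (m !) ℚ.* ℕ→ℚ (D ^ m))
      ≡⟨ cong₂ ℚ._*_ (poch-clear c≡ m) (trans (sym (ℕ→ℚ-* (m !) (D ^ m))) (cong ℕ→ℚ (!-clear D m))) ⟩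
    ℕ→ℚ (risingProduct D γ m) ℚ.* ℕ→ℚ (risingProduct D D m)
      ≡⟨ ℕ→ℚ-* (risingProduct D γ m) (risingProduct D D m) ⟨
    ℕ→ℚ (risingProduct D γ m * risingProduct D D m) ∎
  -- This excludes the default value of `⊘`: a zero here would make a product of positive naturals
  -- vanish.
  denominator≢0 : poch c m ℚ.* ℕ→ℚ (m !) ≢ 0ℚ
  denominator≢0 eq = ≢-nonZero⁻¹ _ {{m*n≢0 _ _ {{risingProduct-nonZero D 0<γ m}} {{risingProduct-nonZero D (>-nonZero⁻¹ D) m}}}}
    (ℕ→ℚ-injective (trans (sym denominator)
      (trans (cong (ℚ._* (ℕ→ℚ (D ^ m) ℚ.* ℕ→ℚ (D ^ m))) eq) (ℚ.*-zeroˡ (ℕ→ℚ (D ^ m) ℚ.* ℕ→ℚ (D ^ m))))))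

-- Powers of a prime in reduced denominators

reduced : ∀ q → Coprime ∣ ↥ q ∣ (↧ₙ q)
reduced (mkℚ n d-1 n⊥d) = Coprime.recompute n⊥d

module _ {p : ℕ} (pr : Prime p) (q : ℚ) {num den : ℕ} (eq : q ℚ.* ℕ→ℚ den ≡ ℕ→ℚ num) where

  -- Cross-multiplication and cancellation of `num` leave `p ^ R` dividing `u * ↧ₙ q`, with `u`
  -- prime to `p`.
  ^∣denominator : ∀ R .{{_ : NonZero num}} → p ^ R * num ≼[ p ] den → p ^ R ∣ ↧ₙ q
  ^∣denominator R (≼-by u p∤u (divides w den*u≡)) =
    coprime-divisor (Coprime.sym (coprime-^ʳ R (Coprime.sym (prime-∤⇒coprime pr p∤u))))
      (divides (∣ ↥ q ∣ * w) (*-cancelˡ-≡ _ _ num (begin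
        num * (u * ↧ₙ q)             ≡⟨ lemma₁ num u (↧ₙ q) ⟩
        num * ↧ₙ q * u               ≡⟨ cong (_* u) (cross-multiply q den num eq) ⟨
        ∣ ↥ q ∣ * den * u            ≡⟨ *-assoc ∣ ↥ q ∣ den u ⟩
        ∣ ↥ q ∣ * (den * u)          ≡⟨ cong (∣ ↥ q ∣ *_) den*u≡ ⟩
        ∣ ↥ q ∣ * (w * (p ^ R * num)) ≡⟨ lemma₂ ∣ ↥ q ∣ w (p ^ R) num ⟩
        num * (∣ ↥ q ∣ * w * p ^ R)  ∎)))
    where
    open ≡-Reasoning
    lemma₁ : ∀ n u d → n * (u * d) ≡ n * d * u
    lemma₁ = solve-∀
    lemma₂ : ∀ t w r n → t * (w * (r * n)) ≡ n * (t * w * r)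
    lemma₂ = solve-∀

  -- Cancellation of `den` makes `↧ₙ q` a divisor of `∣ ↥ q ∣ * u`, so `p` would divide both parts
  -- of a reduced fraction.
  ∤denominator : .{{_ : NonZero den}} → den ≼[ p ] num → p ∤ ↧ₙ q
  ∤denominator (≼-by u p∤u (divides w num*u≡)) p∣d =
    prime∤1 pr (subst (p ∣_) (reduced q (p∣n , p∣d)) ∣-refl)
    where
    open ≡-Reasoning
    tu≡wd : ∣ ↥ q ∣ * u ≡ w * ↧ₙ q
    tu≡wd = *-cancelˡ-≡ _ _ den (begin
      den * (∣ ↥ q ∣ * u)   ≡⟨ lemma₁ den ∣ ↥ q ∣ u ⟩
      ∣ ↥ q ∣ * den * u     ≡⟨ cong (_* u) (cross-multiply q den num eq) ⟩
      num * ↧ₙ q * u        ≡⟨ lemma₂ num (↧ₙ q) u ⟩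
      num * u * ↧ₙ q        ≡⟨ cong (_* ↧ₙ q) num*u≡ ⟩
      w * den * ↧ₙ q        ≡⟨ lemma₃ w den (↧ₙ q) ⟩
      den * (w * ↧ₙ q)      ∎)
      where
      lemma₁ : ∀ d t u → d * (t * u) ≡ t * d * u
      lemma₁ = solve-∀
      lemma₂ : ∀ n d u → n * d * u ≡ n * u * d
      lemma₂ = solve-∀
      lemma₃ : ∀ w e d → w * e * d ≡ e * (w * d)
      lemma₃ = solve-∀
    p∣n : p ∣ ∣ ↥ q ∣
    p∣n with euclidsLemma ∣ ↥ q ∣ u pr (subst (p ∣_) (sym tu≡wd) (∣n⇒∣m*n w p∣d))
    ... | inj₁ p∣n = p∣n
    ... | inj₂ p∣u = contradiction p∣u p∤u

-- The three conditions in terms of numerators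

lcm-nonZero : ∀ m n .{{_ : NonZero m}} .{{_ : NonZero n}} → NonZero (lcm m n)
lcm-nonZero m n = ≢-nonZero λ lcm≡0 → ≢-nonZero⁻¹ (m * n) {{m*n≢0 m n}}
  (0∣⇒≡0 (subst (_∣ m * n) lcm≡0 (lcm-least {m} {n} (m∣m*n n) (n∣m*n m))))

module _ {D : ℕ} .{{D≢0 : NonZero D}} where

  private
    instance
      D-positive : ℚ.Positive (ℕ→ℚ D)
      D-positive = ℚ.positive (ℕ→ℚ-mono-< (>-nonZero⁻¹ D))

  scale-< : ∀ {a b α β} → a HasNumerator α Over D → b HasNumerator β Over D → a <ℚ b → α < β
  scale-< (cleared a≡) (cleared b≡) a<b = ℕ→ℚ-cancel-< (subst₂ _<ℚ_ a≡ b≡ (ℚ.*-monoˡ-<-pos (ℕ→ℚ D) a<b))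

  unscale-< : ∀ {a b α β} → a HasNumerator α Over D → b HasNumerator β Over D → α < β → a <ℚ b
  unscale-< (cleared a≡) (cleared b≡) α<β = ℚ.*-cancelʳ-<-nonNeg (ℕ→ℚ D) {{ℚ.pos⇒nonNeg (ℕ→ℚ D)}}
    (subst₂ _<ℚ_ (sym a≡) (sym b≡) (ℕ→ℚ-mono-< α<β))

  module ClearedParameters {a b c α β γ} (a≡ : a HasNumerator α Over D) (b≡ : b HasNumerator β Over D) (c≡ : c HasNumerator γ Over D)
           (0<α : 0 < α) (α<D : α < D) (0<β : 0 < β) (β<D : β < D) (0<γ : 0 < γ) (γ<D : γ < D) where

    private
      Q = risingProduct D

    c-smallest⇒InS : γ < α → γ < β → ∀ {p} → Prime p → D < p → InS a b c p
    c-smallest⇒InS γ<α γ<β pr D<p k with ratio-unbounded pr D<p α<D β<D γ<α γ<β k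
    ... | m , pᵏnum≼den = m , ^∣denominator pr (coeff a b c m) (coeff-clear 0<γ a≡ b≡ c≡ m) k
      {{m*n≢0 (Q α m) (Q β m) {{risingProduct-nonZero D 0<α m}} {{risingProduct-nonZero D 0<β m}}}} pᵏnum≼den

    coefficients-integral : ∀ {p} → Prime p → (∀ m → Q γ m * Q D m ≼[ p ] Q α m * Q β m) → ¬ InS a b c p
    coefficients-integral {p} pr den≼num unbounded with unbounded 1
    ... | m , p^1∣ = ∤denominator pr (coeff a b c m) (coeff-clear 0<γ a≡ b≡ c≡ m)
      {{m*n≢0 (Q γ m) (Q D m) {{risingProduct-nonZero D 0<γ m}} {{risingProduct-nonZero D (>-nonZero⁻¹ D) m}}}}
      (den≼num m) (subst (_∣ ↧ₙ coeff a b c m) (*-identityʳ p) p^1∣)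

    InS⇒c-smallest : ∀ {p} → Prime p → D ∣ p ∸ 1 → InS a b c p → γ < α × γ < β
    InS⇒c-smallest {p} pr D∣p-1 unbounded = ≰⇒> α≰γ , ≰⇒> β≰γ
      where
      bound : ∀ {δ ε} → 0 < δ → δ ≤ ε → ε ≤ D → ∀ m → Q ε m ≼[ p ] Q δ m
      bound = risingProduct-≼-1modD pr D∣p-1
      α≰γ : ¬ α ≤ γ
      α≰γ α≤γ = coefficients-integral pr
        (λ m → ≼-* pr (bound 0<α α≤γ (<⇒≤ γ<D) m) (bound 0<β (<⇒≤ β<D) ≤-refl m)) unbounded
      β≰γ : ¬ β ≤ γ
      β≰γ β≤γ = coefficients-integral pr
        (λ m → subst (Q γ m * Q D m ≼[ p ]_) (*-comm (Q β m) (Q α m))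
          (≼-* pr (bound 0<β β≤γ (<⇒≤ γ<D) m) (bound 0<α (<⇒≤ α<D) ≤-refl m))) unbounded

theorem4p12 : (a b c : ℚ) → Admissible a b c →
    ((c <ℚ a × c <ℚ b) ⇔ (∃ λ N → ∀ (p : ℕ) → Prime p → N ≤ p → InS a b c p))
    × ((∃ λ N → ∀ (p : ℕ) → Prime p → N ≤ p → InS a b c p)
    ⇔ (∀ (N : ℕ) → ∃ λ p → Prime p × N < p × denLcm a b c ∣ p ∸ 1 × InS a b c p))
theorem4p12 a b c ((0<a , a<1) , (0<b , b<1) , (0<c , c<1) , _) =
  -- Both equivalences come from the cycle (i) ⇒ (ii) ⇒ (iii) ⇒ (i).
  mk⇔ i⇒ii (λ ii → iii⇒i (ii⇒iii ii)) , mk⇔ ii⇒iii (λ iii → i⇒ii (iii⇒i iii))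
  where
  D = denLcm a b c
  instance
    D≢0 : NonZero D
    D≢0 = lcm-nonZero (lcm (↧ₙ a) (↧ₙ b)) (↧ₙ c) {{lcm-nonZero (↧ₙ a) (↧ₙ b)}}
  0≡ : 0ℚ HasNumerator 0 Over D
  0≡ = cleared (ℚ.*-zeroˡ (ℕ→ℚ D))
  1≡ : 1ℚ HasNumerator D Over D
  1≡ = cleared (ℚ.*-identityˡ (ℕ→ℚ D))
  a≡ = proj₂ (clear-denominator {a} {D} 0<a (∣-trans (m∣lcm[m,n] (↧ₙ a) (↧ₙ b)) (m∣lcm[m,n] (lcm (↧ₙ a) (↧ₙ b)) (↧ₙ c))))
  b≡ = proj₂ (clear-denominator {b} {D} 0<b (∣-trans (n∣lcm[m,n] (↧ₙ a) (↧ₙ b)) (m∣lcm[m,n] (lcm (↧ₙ a) (↧ₙ b)) (↧ₙ c))))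
  c≡ = proj₂ (clear-denominator {c} {D} 0<c (n∣lcm[m,n] (lcm (↧ₙ a) (↧ₙ b)) (↧ₙ c)))

  open ClearedParameters {D} a≡ b≡ c≡
    (scale-< 0≡ a≡ 0<a) (scale-< a≡ 1≡ a<1) (scale-< 0≡ b≡ 0<b) (scale-< b≡ 1≡ b<1) (scale-< 0≡ c≡ 0<c) (scale-< c≡ 1≡ c<1)

  i⇒ii : c <ℚ a × c <ℚ b → ∃ λ N → ∀ (p : ℕ) → Prime p → N ≤ p → InS a b c p
  i⇒ii (c<a , c<b) = suc D , λ p pr D<p →
    c-smallest⇒InS (scale-< c≡ a≡ c<a) (scale-< c≡ b≡ c<b) pr D<p

  ii⇒iii : (∃ λ N → ∀ (p : ℕ) → Prime p → N ≤ p → InS a b c p) →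
    ∀ (N : ℕ) → ∃ λ p → Prime p × N < p × D ∣ p ∸ 1 × InS a b c p
  ii⇒iii (N₀ , InS-beyond) N = beyond (prime≡1mod D (>-nonZero⁻¹ D) (N₀ + N))
    where
    beyond : (∃ λ p → Prime p × N₀ + N < p × D ∣ p ∸ 1) → ∃ λ p → Prime p × N < p × D ∣ p ∸ 1 × InS a b c p
    beyond (p , pr , N₀+N<p , D∣p-1) = p , pr , ≤-<-trans (m≤n+m N N₀) N₀+N<p , D∣p-1 ,
      InS-beyond p pr (≤-trans (m≤m+n N₀ N) (<⇒≤ N₀+N<p))

  iii⇒i : (∀ (N : ℕ) → ∃ λ p → Prime p × N < p × D ∣ p ∸ 1 × InS a b c p) → c <ℚ a × c <ℚ b
  iii⇒i iii = unscale-< c≡ a≡ (proj₁ γ<α,β) , unscale-< c≡ b≡ (proj₂ γ<α,β)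
    -- A single prime congruent to 1 modulo `D` suffices.
    where γ<α,β = (λ (p , pr , _ , D∣p-1 , unbounded) → InS⇒c-smallest pr D∣p-1 unbounded) (iii 0)
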